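{- There exists a function $f:\mathbb{N}\to\mathbb{N}$ such that for every $k\ge 0$, every graph with treewidth $k$ has basis number at most $f(k)$.
   Context: All graphs are finite and simple. For a graph $G$, the subsets of $E(G)$ form an $\mathbb{F}_2$-vector space with symmetric difference as addition; subgraphs are identified with their edge sets. An $\mathbb{F}_2$-cycle is a subgraph all of whose vertices have even degree; these form the cycle space, and a cycle basis is a basis of it. The congestion of a family $X_1,\dots,X_n$ of subgraphs is $\max_{e\in E(G)}|\{i:e\in X_i\}|$. The basis number $\mathrm{bn}(G)$ is the minimum congestion of a cycle basis of $G$. Treewidth is the standard notion. -}

module Defs where

open import Data.Nat using (ℕ; zero; suc; _+_; _*_; _∸_; _≤_; _⊔_)
open import Data.Fin using (Fin; zero; suc; _≟_)
open import Data.Bool using (Bool; true; false; _∧_; _∨_; _xor_; if_then_else_)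
open import Data.Product using (Σ; ∃; _×_; _,_; proj₁; proj₂)
open import Data.Sum using (_⊎_)
open import Data.Unit using (⊤)
open import Relation.Nullary using (¬_)
open import Relation.Nullary.Decidable using (⌊_⌋)
open import Relation.Binary.PropositionalEquality using (_≡_; _≢_)

record Graph : Set where
  field
    n    : ℕ
    m    : ℕ
    ends : Fin m → Fin n × Fin n
    loopless : ∀ e → proj₁ (ends e) ≢ proj₂ (ends e)
    simple   : ∀ e e′ →
               (ends e ≡ ends e′ ⊎ (proj₁ (ends e) ≡ proj₂ (ends e′) × proj₂ (ends e) ≡ proj₁ (ends e′)))
               → e ≡ e′

open Graph public

Vertex : Graph → Set
Vertex G = Fin (n G)

Edge : Graph → Set
Edge G = Fin (m G)

Adj : (G : Graph) → Vertex G → Vertex G → Set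
Adj G u v = ∃ λ (e : Edge G) → ends G e ≡ (u , v) ⊎ ends G e ≡ (v , u)

count : ∀ {k} → (Fin k → Bool) → ℕ
count {zero}  p = 0
count {suc k} p = (if p zero then 1 else 0) + count (λ i → p (suc i))

xorSum : ∀ {k} → (Fin k → Bool) → Bool
xorSum {zero}  p = false
xorSum {suc k} p = p zero xor xorSum (λ i → p (suc i))

maxF : ∀ {k} → (Fin k → ℕ) → ℕ
maxF {zero}  f = 0
maxF {suc k} f = f zero ⊔ maxF (λ i → f (suc i))

-- Edge sets (subgraphs identified with edge sets), the F₂ structure

EdgeSet : Graph → Set
EdgeSet G = Edge G → Bool

_⊕_ : ∀ {G} → EdgeSet G → EdgeSet G → EdgeSet G
(X ⊕ Y) e = X e xor Y e

lincomb : ∀ {G k} → (Fin k → EdgeSet G) → (Fin k → Bool) → EdgeSet G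
lincomb X c e = xorSum (λ i → c i ∧ X i e)

incident : (G : Graph) → Vertex G → Edge G → Bool
incident G v e = ⌊ proj₁ (ends G e) ≟ v ⌋ ∨ ⌊ proj₂ (ends G e) ≟ v ⌋

degree : (G : Graph) → EdgeSet G → Vertex G → ℕ
degree G X v = count (λ e → X e ∧ incident G v e)

Even : ℕ → Set
Even d = ∃ λ k → d ≡ 2 * k

IsF2Cycle : (G : Graph) → EdgeSet G → Set
IsF2Cycle G X = ∀ v → Even (degree G X v)

record CycleBasis (G : Graph) : Set where
  field
    size     : ℕ
    elems    : Fin size → EdgeSet G
    cycles   : ∀ i → IsF2Cycle G (elems i)
    indep    : ∀ (c : Fin size → Bool) → (∀ e → lincomb {G} elems c e ≡ false) → ∀ i → c i ≡ false
    spanning : ∀ (C : EdgeSet G) → IsF2Cycle G C → ∃ λ (c : Fin size → Bool) → ∀ e → lincomb {G} elems c e ≡ C e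

open CycleBasis public

congestion : (G : Graph) → ∀ {k} → (Fin k → EdgeSet G) → ℕ
congestion G X = maxF (λ e → count (λ i → X i e))

-- bn(G) ≤ N : the minimum congestion of a cycle basis is at most N,
-- i.e. some cycle basis has congestion at most N
BasisNumberAtMost : Graph → ℕ → Set
BasisNumberAtMost G N = Σ (CycleBasis G) λ B → congestion G (elems B) ≤ N

data Walk (G : Graph) (P : Vertex G → Set) : Vertex G → Vertex G → Set where
  here : ∀ {x} → P x → Walk G P x x
  step : ∀ {x y z} → P x → Adj G x y → Walk G P y z → Walk G P x z

Connected : Graph → Set
Connected G = ∀ (x y : Vertex G) → Walk G (λ _ → ⊤) x y

next : ∀ {l} → Fin (suc l) → Fin (suc l)
next {l} i with Data.Fin.toℕ i Data.Nat.<? l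
... | Relation.Nullary.yes p = suc (Data.Fin.fromℕ< p)
... | Relation.Nullary.no _  = zero
  where import Data.Nat

record GraphCycle (G : Graph) : Set where
  field
    len′   : ℕ
    vert   : Fin (suc (suc (suc len′))) → Vertex G
    inj    : ∀ i j → vert i ≡ vert j → i ≡ j
    adj    : ∀ i → Adj G (vert i) (vert (next i))

Acyclic : Graph → Set
Acyclic G = ¬ GraphCycle G

IsTree : Graph → Set
IsTree T = (1 ≤ n T) × Connected T × Acyclic T

record TreeDecomposition (G : Graph) : Set where
  field
    tree    : Graph
    isTree  : IsTree tree
    bag     : Vertex tree → Vertex G → Bool
    vcover  : ∀ (v : Vertex G) → ∃ λ x → bag x v ≡ true
    ecover  : ∀ (e : Edge G) → ∃ λ x → bag x (proj₁ (ends G e)) ≡ true × bag x (proj₂ (ends G e)) ≡ true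
    subtree : ∀ (v : Vertex G) (x y : Vertex tree) → bag x v ≡ true → bag y v ≡ true →
              Walk tree (λ z → bag z v ≡ true) x y

open TreeDecomposition public

width : ∀ {G} → TreeDecomposition G → ℕ
width D = maxF (λ x → count (bag D x)) ∸ 1

Treewidth : Graph → ℕ → Set
Treewidth G k = (∃ λ (D : TreeDecomposition G) → width D ≡ k) × (∀ (D : TreeDecomposition G) → k ≤ width D)

module Submission where

-- By a tree decomposition, the edges of G become the leaves of a binary tree t in which the edges
-- below a node share at most K = k + 1 vertices with the others. Cycles are built from the root of t
-- downwards. Below a node one has to find, for every element of a list of boundary vectors of bounded
-- length ("demands"), an edge set with that boundary, such that these edge sets and a generating set of
-- the cycles below the node put a bounded load on every edge. At a node, a demand splits into one
-- demand for each child, uniquely up to the intersection of the ranges of the boundary maps of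
-- the two children; a basis of this intersection also gives the new cycles that pass through the node.
--
-- The point is to keep the number of nonzero demands bounded along arbitrarily deep trees. Demands are
-- recorded by their coordinates with respect to a list of vectors, ordered by age, to which each node
-- appends such a basis. They are kept in bundles of 2 ^ P, and each bundle runs uniformly through a
-- coset of the span of the newest vectors: as new vectors are appended, the freedom in splitting
-- demands is used to spread every bundle evenly over the larger coset. When more than K vectors are
-- present, one of them depends on newer ones and is eliminated. Thus the coset of a bundle gradually
-- becomes the whole span of the vectors not older than its own block, and then a fixed
-- proportion of the bundle consists of zero vectors, which need no edges at all. This contraction
-- pays for the merging of the blocks of two adjacent vectors when one of them is eliminated.

open import Defs
open import Data.Bool using (Bool; true; false; _∧_; _∨_; _xor_; if_then_else_)
open import Data.Bool.Properties
  using (xor-same; xor-assoc; xor-comm; xor-identityʳ; ∧-distribʳ-xor; ∧-identityʳ; ∧-zeroʳ)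
import Data.Bool.Properties as Bool
open import Data.Empty using (⊥; ⊥-elim)
open import Data.Fin using (Fin; zero; suc; toℕ; fromℕ<; _≟_)
import Data.Fin.Properties as Fin
open import Data.List
  using (List; []; _∷_; length; map; _++_; concatMap; filter; take; drop; cartesianProductWith; allFin)
import Data.List as List
open import Data.List.Properties
  using (length-map; length-++; length-replicate; length-take; length-drop; take++drop≡id; length-zipWith; filter-notAll)
open import Data.List.Membership.Propositional using (_∈_; find; lose)
open import Data.List.Membership.Propositional.Properties
  using (∈-map⁺; ∈-++⁺ˡ; ∈-++⁺ʳ; ∈-filter⁺; ∈-filter⁻; ∈-cartesianProductWith⁺; ∈-concatMap⁺; ∈-allFin; ∈-lookup)
open import Data.List.Relation.Binary.Sublist.Propositional using (_⊆_; []; _∷_; _∷ʳ_)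
open import Data.List.Relation.Binary.Sublist.Propositional.Properties using (All-resp-⊆)
open import Data.List.Relation.Unary.All using (All; []; _∷_)
import Data.List.Relation.Unary.All as All
import Data.List.Relation.Unary.All.Properties as All
open import Data.List.Relation.Unary.AllPairs using ([]; _∷_)
open import Data.List.Relation.Unary.Any using (Any; here; there; any?)
import Data.List.Relation.Unary.Any as Any
open import Data.List.Relation.Unary.Unique.Propositional using (Unique)
import Data.List.Relation.Unary.Unique.Propositional.Properties as Unique
open import Data.Nat hiding (_≟_; parity)
open import Data.Nat.DivMod using (m≡m%n+[m/n]*n; m%n<n; m/n*n≤m)
open import Data.Nat.Properties hiding (_≟_)
open import Data.Nat.Solver using (module +-*-Solver)
open import Data.Product using (∃; _×_; _,_; proj₁; proj₂)
open import Data.Product.Properties using (≡-dec)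
open import Data.Sum using (_⊎_; inj₁; inj₂; [_,_]′; swap)
open import Data.Unit using (⊤; tt)
open import Data.Vec using (Vec; []; _∷_; replicate; zipWith)
import Data.Vec as Vec
import Data.Vec.Properties as Vec
open import Function using (_∘_; id)
open import Relation.Binary.PropositionalEquality
open import Relation.Nullary using (¬_; Dec; yes; no; ¬?; does)
open import Relation.Nullary.Decidable using (⌊_⌋; map′; _⊎-dec_; _×-dec_)

private variable
  I I′ A B E : Set
  ℓ ν p q : ℕ

-- Vectors over F₂

F₂ : Set → Set
F₂ I = I → Bool

infixl 6 _⊞_ _⊹_

_⊞_ : F₂ I → F₂ I → F₂ I
(x ⊞ y) i = x i xor y i

𝟎 : F₂ I
𝟎 _ = false

_⊙_ : Bool → F₂ I → F₂ I
(s ⊙ x) i = s ∧ x i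

xor-interchange : ∀ a b c d → (a xor b) xor (c xor d) ≡ (a xor c) xor (b xor d)
xor-interchange false b c d = trans (sym (xor-assoc b c d)) (trans (cong (_xor d) (xor-comm b c)) (xor-assoc c b d))
xor-interchange true false c d = trans (Bool.true-xor (c xor d)) (Bool.not-distribˡ-xor c d)
xor-interchange true true false d = sym (Bool.not-involutive d)
xor-interchange true true true d = refl

xor-cancelˡ : ∀ a b → a xor (a xor b) ≡ b
xor-cancelˡ a b = trans (sym (xor-assoc a a b)) (cong (_xor b) (xor-same a))

xor≡false : ∀ {a b} → a xor b ≡ false → a ≡ b
xor≡false {a} {b} eq = trans (sym (xor-identityʳ a)) (trans (cong (a xor_) (sym eq)) (xor-cancelˡ a b))

xor-falseʳ : ∀ {a b} → b ≡ false → a xor b ≡ a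
xor-falseʳ {a} refl = xor-identityʳ a

_⊹_ : Vec Bool p → Vec Bool p → Vec Bool p
_⊹_ = zipWith _xor_

0̂ : Vec Bool p
0̂ = replicate _ false

⊹-identityˡ : (c : Vec Bool p) → 0̂ ⊹ c ≡ c
⊹-identityˡ [] = refl
⊹-identityˡ (s ∷ c) = cong (s ∷_) (⊹-identityˡ c)

⊹-⊹ : (c a : Vec Bool p) → c ⊹ a ⊹ a ≡ c
⊹-⊹ [] [] = refl
⊹-⊹ (s ∷ c) (t ∷ a) =
  cong₂ _∷_ (trans (xor-assoc s t t) (trans (cong (s xor_) (xor-same t)) (xor-identityʳ s))) (⊹-⊹ c a)

_≟₀ : (c : Vec Bool p) → Dec (c ≡ 0̂)
[] ≟₀ = yes refl
(true ∷ c) ≟₀ = no λ ()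
(false ∷ c) ≟₀ = map′ (cong (false ∷_)) (λ { refl → refl }) (c ≟₀)

lin : Vec Bool p → Vec (F₂ I) p → F₂ I
lin [] [] = 𝟎
lin (c ∷ cs) (x ∷ xs) = c ⊙ x ⊞ lin cs xs

lin-0̂ : (xs : Vec (F₂ I) p) → lin 0̂ xs ≗ 𝟎
lin-0̂ [] i = refl
lin-0̂ (x ∷ xs) i = lin-0̂ xs i

lin-⊹ : (c d : Vec Bool p) (xs : Vec (F₂ I) p) → lin (c ⊹ d) xs ≗ lin c xs ⊞ lin d xs
lin-⊹ [] [] [] i = refl
lin-⊹ (s ∷ c) (t ∷ d) (x ∷ xs) i =
  trans (cong₂ _xor_ (Bool.∧-distribʳ-xor (x i) s t) (lin-⊹ c d xs i))
        (xor-interchange (s ∧ x i) (t ∧ x i) _ _)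

lin-++ : (c : Vec Bool p) (d : Vec Bool q) (xs : Vec (F₂ I) p) (ys : Vec (F₂ I) q) →
         lin (c Vec.++ d) (xs Vec.++ ys) ≗ lin c xs ⊞ lin d ys
lin-++ [] d [] ys i = refl
lin-++ (s ∷ c) d (x ∷ xs) ys i =
  trans (cong ((s ∧ x i) xor_) (lin-++ c d xs ys i)) (sym (xor-assoc (s ∧ x i) _ _))

lin-∘ : (f : I′ → I) (c : Vec Bool p) (xs : Vec (F₂ I) p) → lin c xs ∘ f ≗ lin c (Vec.map (_∘ f) xs)
lin-∘ f [] [] i = refl
lin-∘ f (s ∷ c) (x ∷ xs) i = cong ((s ∧ x (f i)) xor_) (lin-∘ f c xs i)

-- Over F₂ sums suffice. Pointwise equality is built in because edge sets are functions.
data Span (L : List (F₂ I)) : F₂ I → Set where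
  zero : ∀ {x} → x ≗ 𝟎 → Span L x
  add  : ∀ {x y z} → z ∈ L → Span L y → x ≗ z ⊞ y → Span L x

Span-resp : ∀ {L : List (F₂ I)} {x y} → x ≗ y → Span L y → Span L x
Span-resp eq (zero y≗𝟎) = zero λ i → trans (eq i) (y≗𝟎 i)
Span-resp eq (add z∈L s y≗) = add z∈L s λ i → trans (eq i) (y≗ i)

Span-⊞ : ∀ {L : List (F₂ I)} {x y} → Span L x → Span L y → Span L (x ⊞ y)
Span-⊞ {y = y} (zero x≗𝟎) t = Span-resp (λ i → cong (_xor y i) (x≗𝟎 i)) t
Span-⊞ {y = y} (add {y = w} {z} z∈L s x≗) t =
  add z∈L (Span-⊞ s t) λ i → trans (cong (_xor y i) (x≗ i)) (xor-assoc (z i) (w i) (y i))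

Span-map : ∀ {L : List (F₂ I)} {M : List (F₂ I′)} (f : F₂ I → F₂ I′) →
           (∀ {x y} → x ≗ y → f x ≗ f y) → f 𝟎 ≗ 𝟎 → (∀ x y → f (x ⊞ y) ≗ f x ⊞ f y) →
           (∀ {z} → z ∈ L → f z ∈ M) → ∀ {x} → Span L x → Span M (f x)
Span-map f resp f𝟎 f⊞ f∈ (zero x≗𝟎) = zero λ i → trans (resp x≗𝟎 i) (f𝟎 i)
Span-map f resp f𝟎 f⊞ f∈ (add z∈L s x≗) =
  add (f∈ z∈L) (Span-map f resp f𝟎 f⊞ f∈ s) λ i → trans (resp x≗ i) (f⊞ _ _ i)

-- Bounded dimension forces linear relations

Linear : (Vec Bool p → F₂ I) → Set
Linear L = ∀ c d → L (c ⊹ d) ≗ L c ⊞ L d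

Supported : F₂ I → F₂ I → Set
Supported A x = ∀ i → A i ≡ false → x i ≡ false

-- A hyperplane inside the kernel of `f`, given by an injective linear parametrisation, so that an
-- induction can go on with p coefficients.
record Subspace (p : ℕ) (f : Vec Bool (suc p) → Bool) : Set where
  field
    embed     : Vec Bool p → Vec Bool (suc p)
    embed-⊹   : ∀ c d → embed (c ⊹ d) ≡ embed c ⊹ embed d
    injective : ∀ c → embed c ≡ 0̂ → c ≡ 0̂
    kernel    : ∀ c → f (embed c) ≡ false

-- The first coordinate whose unit vector has value `true` is solved for in terms of the later ones;
-- the coordinates before it stay free. If there is none, the last coordinate is set to 0.
hyperplane : ∀ p (f : Vec Bool (suc p) → Bool) → (∀ c d → f (c ⊹ d) ≡ f c xor f d) → Subspace p f
hyperplane p f f-⊹ with f (true ∷ 0̂) in eq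
... | true = record
  { embed     = λ c → f (false ∷ c) ∷ c
  ; embed-⊹   = λ c d → cong (_∷ (c ⊹ d)) (f-⊹ (false ∷ c) (false ∷ d))
  ; injective = λ { c e → cong Vec.tail e }
  ; kernel    = ker
  }
  where
  ker : ∀ c → f (f (false ∷ c) ∷ c) ≡ false
  ker c with f (false ∷ c) in e
  ... | false = e
  ... | true  = trans (cong (f ∘ (true ∷_)) (sym (⊹-identityˡ c)))
                (trans (f-⊹ (true ∷ 0̂) (false ∷ c)) (cong₂ _xor_ eq e))
hyperplane zero f f-⊹ | false = record
  { embed     = λ _ → false ∷ []
  ; embed-⊹   = λ _ _ → refl
  ; injective = λ { [] _ → refl }
  ; kernel    = λ _ → trans (f-⊹ (true ∷ []) (true ∷ [])) (xor-same (f (true ∷ [])))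
  }
hyperplane (suc p) f f-⊹ | false = record
  { embed     = λ { (s ∷ c) → s ∷ embed c }
  ; embed-⊹   = λ { (s ∷ c) (t ∷ d) → cong ((s xor t) ∷_) (embed-⊹ c d) }
  ; injective = λ { (false ∷ c) e → cong (false ∷_) (injective c (cong Vec.tail e)) }
  ; kernel    = λ { (false ∷ c) → kernel c
                  ; (true ∷ c) → trans (cong (f ∘ (true ∷_)) (sym (⊹-identityˡ (embed c))))
                                 (trans (f-⊹ (true ∷ 0̂) (false ∷ embed c)) (cong₂ _xor_ eq (kernel c))) }
  }
  where open Subspace (hyperplane p (f ∘ (false ∷_)) λ c d → f-⊹ (false ∷ c) (false ∷ d))

-- Each coordinate in `A` costs one dimension, since the coefficients are restricted to a hyperplane
-- on which it vanishes; the coordinates outside `A` vanish anyway.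
relation : (A : F₂ (Fin ν)) (L : Vec Bool p → F₂ (Fin ν)) → Linear L → (∀ c → Supported A (L c)) →
           count A < p → ∃ λ c → c ≢ 0̂ × L c ≗ 𝟎
relation {zero} {suc p} A L lin supp _ = true ∷ 0̂ , (λ ()) , λ ()
relation {suc ν} {suc p} A L lin supp lt with A zero in eq
... | false = let c , c≢ , Lc = relation (A ∘ suc) (λ c → L c ∘ suc) (λ c d → lin c d ∘ suc)
                                  (λ c → supp c ∘ suc) lt
              in c , c≢ , λ { zero → supp c zero eq ; (suc i) → Lc i }
relation {suc ν} {suc p} A L lin supp (s≤s lt) | true =
  let c , c≢ , Lc = relation (A ∘ suc) (λ c → L (embed c) ∘ suc)
                      (λ c d i → trans (cong (λ e → L e (suc i)) (embed-⊹ c d)) (lin (embed c) (embed d) (suc i)))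
                      (λ c → supp (embed c) ∘ suc) lt
  in embed c , c≢ ∘ injective c , λ { zero → kernel c ; (suc i) → Lc i }
  where open Subspace (hyperplane p (λ c → L c zero) (λ c d → lin c d zero))

-- Greedy selection of an independent subfamily

∃Vec? : ∀ p {Q : Vec Bool p → Set} → (∀ c → Dec (Q c)) → Dec (∃ Q)
∃Vec? zero Q? = map′ ([] ,_) (λ { ([] , q) → q }) (Q? [])
∃Vec? (suc p) Q? =
  map′ (λ { (inj₁ (c , q)) → true ∷ c , q ; (inj₂ (c , q)) → false ∷ c , q })
       (λ { (true ∷ c , q) → inj₁ (c , q) ; (false ∷ c , q) → inj₂ (c , q) })
       (∃Vec? p (Q? ∘ (true ∷_)) ⊎-dec ∃Vec? p (Q? ∘ (false ∷_)))

_≗?_ : (x y : F₂ (Fin ν)) → Dec (x ≗ y)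
x ≗? y = Fin.all? λ i → x i Bool.≟ y i

module _ (val : A → F₂ (Fin ν)) where

  combination : (L : List A) → Vec Bool (length L) → F₂ (Fin ν)
  combination L c = lin c (Vec.map val (Vec.fromList L))

  -- Independence concerns the values, so that edge sets can be selected by their boundaries. Being
  -- a sublist preserves congestion bounds and properties of the members.
  record Selection (L : List A) : Set where
    field
      chosen      : List A
      sublist     : chosen ⊆ L
      independent : ∀ c → combination chosen c ≗ 𝟎 → c ≡ 0̂
      spanning    : ∀ {x} → x ∈ L → ∃ λ c → val x ≗ combination chosen c

  select : (L : List A) → Selection L
  select [] = record { chosen = [] ; sublist = [] ; independent = λ { [] _ → refl } ; spanning = λ () }
  select (x ∷ L) with select L
  ... | record { chosen = xs ; sublist = sub ; independent = ind ; spanning = spa }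
    with ∃Vec? (length xs) (λ c → val x ≗? combination xs c)
  ... | yes dep = record
        { chosen = xs ; sublist = x ∷ʳ sub ; independent = ind
        ; spanning = λ { (here refl) → dep ; (there x∈L) → spa x∈L } }
  ... | no ¬dep = record
        { chosen = x ∷ xs ; sublist = refl ∷ sub
        ; independent = λ { (false ∷ c) e → cong (false ∷_) (ind c e)
                          ; (true ∷ c) e → ⊥-elim (¬dep (c , λ i → xor≡false (e i))) }
        ; spanning = λ { (here refl) → true ∷ 0̂ , λ i →
                         sym (trans (cong (val x i xor_) (lin-0̂ (Vec.map val (Vec.fromList xs)) i)) (xor-identityʳ _))
                       ; (there x∈L) → let c , e = spa x∈L in false ∷ c , e } }

-- Sums

Σₗ : (A → ℕ) → List A → ℕ
Σₗ g [] = 0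
Σₗ g (x ∷ L) = g x + Σₗ g L

Σₗ-++ : (g : A → ℕ) (L M : List A) → Σₗ g (L ++ M) ≡ Σₗ g L + Σₗ g M
Σₗ-++ g [] M = refl
Σₗ-++ g (x ∷ L) M = trans (cong (g x +_) (Σₗ-++ g L M)) (sym (+-assoc (g x) _ _))

Σₗ-map : (g : B → ℕ) (f : A → B) (L : List A) → Σₗ g (map f L) ≡ Σₗ (g ∘ f) L
Σₗ-map g f [] = refl
Σₗ-map g f (x ∷ L) = cong (g (f x) +_) (Σₗ-map g f L)

Σₗ-mono : {g h : A → ℕ} → (∀ x → g x ≤ h x) → ∀ L → Σₗ g L ≤ Σₗ h L
Σₗ-mono g≤h [] = z≤n
Σₗ-mono g≤h (x ∷ L) = +-mono-≤ (g≤h x) (Σₗ-mono g≤h L)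

Σₗ-cong : {g h : A → ℕ} → (∀ x → g x ≡ h x) → ∀ L → Σₗ g L ≡ Σₗ h L
Σₗ-cong g≡h [] = refl
Σₗ-cong g≡h (x ∷ L) = cong₂ _+_ (g≡h x) (Σₗ-cong g≡h L)

+-interchange : ∀ a b c d → (a + b) + (c + d) ≡ (a + c) + (b + d)
+-interchange = solve 4 (λ a b c d → (a :+ b) :+ (c :+ d) := (a :+ c) :+ (b :+ d)) refl
  where open +-*-Solver

Σₗ-+ : (g h : A → ℕ) (L : List A) → Σₗ (λ x → g x + h x) L ≡ Σₗ g L + Σₗ h L
Σₗ-+ g h [] = refl
Σₗ-+ g h (x ∷ L) = trans (cong (g x + h x +_) (Σₗ-+ g h L)) (+-interchange (g x) (h x) _ _)

Σₗ-const : ∀ {g : A → ℕ} {k} → (∀ x → g x ≡ k) → ∀ L → Σₗ g L ≡ length L * k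
Σₗ-const g≡k [] = refl
Σₗ-const g≡k (x ∷ L) = cong₂ _+_ (g≡k x) (Σₗ-const g≡k L)

Σₗ-concatMap : (g : B → ℕ) (f : A → List B) (L : List A) → Σₗ g (concatMap f L) ≡ Σₗ (Σₗ g ∘ f) L
Σₗ-concatMap g f [] = refl
Σₗ-concatMap g f (x ∷ L) = trans (Σₗ-++ g (f x) (concatMap f L)) (cong (Σₗ g (f x) +_) (Σₗ-concatMap g f L))

Σₗ-replicate : (g : A → ℕ) (k : ℕ) (x : A) → Σₗ g (List.replicate k x) ≡ k * g x
Σₗ-replicate g zero x = refl
Σₗ-replicate g (suc k) x = cong (g x +_) (Σₗ-replicate g k x)

Σₗ-∈ : (g : A → ℕ) {x : A} {L : List A} → x ∈ L → g x ≤ Σₗ g L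
Σₗ-∈ g (here refl) = m≤m+n _ _
Σₗ-∈ g {L = y ∷ L} (there x∈L) = ≤-trans (Σₗ-∈ g x∈L) (m≤n+m _ (g y))

m+n≤o⇒n≤o∸m : ∀ m {n o} → m + n ≤ o → n ≤ o ∸ m
m+n≤o⇒n≤o∸m m {n} le = m+n≤o⇒m≤o∸n n (≤-trans (≤-reflexive (+-comm n m)) le)

sumᵥ : (Vec Bool p → ℕ) → ℕ
sumᵥ {zero} g = g []
sumᵥ {suc p} g = sumᵥ (g ∘ (false ∷_)) + sumᵥ (g ∘ (true ∷_))

sumᵥ-mono : {g h : Vec Bool p → ℕ} → (∀ c → g c ≤ h c) → sumᵥ g ≤ sumᵥ h
sumᵥ-mono {zero} g≤h = g≤h []
sumᵥ-mono {suc p} g≤h = +-mono-≤ (sumᵥ-mono (g≤h ∘ (false ∷_))) (sumᵥ-mono (g≤h ∘ (true ∷_)))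

sumᵥ-cong : {g h : Vec Bool p → ℕ} → (∀ c → g c ≡ h c) → sumᵥ g ≡ sumᵥ h
sumᵥ-cong {zero} g≡h = g≡h []
sumᵥ-cong {suc p} g≡h = cong₂ _+_ (sumᵥ-cong (g≡h ∘ (false ∷_))) (sumᵥ-cong (g≡h ∘ (true ∷_)))

sumᵥ-+ : (g h : Vec Bool p → ℕ) → sumᵥ (λ c → g c + h c) ≡ sumᵥ g + sumᵥ h
sumᵥ-+ {zero} g h = refl
sumᵥ-+ {suc p} g h =
  trans (cong₂ _+_ (sumᵥ-+ (g ∘ (false ∷_)) (h ∘ (false ∷_))) (sumᵥ-+ (g ∘ (true ∷_)) (h ∘ (true ∷_))))
        (+-interchange (sumᵥ (g ∘ (false ∷_))) _ _ _)

sumᵥ-const : ∀ p k → sumᵥ {p} (λ _ → k) ≡ 2 ^ p * k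
sumᵥ-const zero k = sym (+-identityʳ k)
sumᵥ-const (suc p) k rewrite sumᵥ-const p k =
  trans (cong (2 ^ p * k +_) (sym (+-identityʳ _))) (sym (*-assoc 2 (2 ^ p) k))

sumᵥ-0 : ∀ p → sumᵥ {p} (λ _ → 0) ≡ 0
sumᵥ-0 p = trans (sumᵥ-const p 0) (*-zeroʳ (2 ^ p))

sumᵥ-shift : (g : Vec Bool p → ℕ) (a : Vec Bool p) → sumᵥ (λ c → g (c ⊹ a)) ≡ sumᵥ g
sumᵥ-shift g [] = refl
sumᵥ-shift g (false ∷ a) = cong₂ _+_ (sumᵥ-shift (g ∘ (false ∷_)) a) (sumᵥ-shift (g ∘ (true ∷_)) a)
sumᵥ-shift g (true ∷ a) =
  trans (cong₂ _+_ (sumᵥ-shift (g ∘ (true ∷_)) a) (sumᵥ-shift (g ∘ (false ∷_)) a))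
        (+-comm (sumᵥ (g ∘ (true ∷_))) _)

sumᵥ-++ : ∀ p {n} (g : Vec Bool (p + n) → ℕ) → sumᵥ g ≡ sumᵥ {p} (λ c → sumᵥ {n} (λ s → g (c Vec.++ s)))
sumᵥ-++ zero g = refl
sumᵥ-++ (suc p) g = cong₂ _+_ (sumᵥ-++ p (g ∘ (false ∷_))) (sumᵥ-++ p (g ∘ (true ∷_)))

sumᵥ-Σₗ : (g : A → Vec Bool p → ℕ) (L : List A) → sumᵥ (λ c → Σₗ (λ x → g x c) L) ≡ Σₗ (sumᵥ ∘ g) L
sumᵥ-Σₗ {p = p} g [] = sumᵥ-0 p
sumᵥ-Σₗ g (x ∷ L) = trans (sumᵥ-+ (g x) _) (cong (sumᵥ (g x) +_) (sumᵥ-Σₗ g L))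

-- Eliminating a coordinate

-- An elimination of one of suc p coordinates: the oldest coordinate is skipped by there, and
-- here a identifies the basis vector of the oldest coordinate with the combination a of the newer ones.
data Elimination : ℕ → Set where
  here  : Vec Bool p → Elimination p
  there : Elimination p → Elimination (suc p)

-- The two vectors over `c` under the quotient map, told apart by the eliminated coordinate `s`. For
-- `here a` this map sends `s ∷ c` to `c` plus `s` times `a`.
preimage : Elimination p → Bool → Vec Bool p → Vec Bool (suc p)
preimage (here a) s c = s ∷ (if s then c ⊹ a else c)
preimage (there k) s (t ∷ c) = t ∷ preimage k s c

sumᵥ-preimage : (k : Elimination p) (g : Vec Bool (suc p) → ℕ) →
                sumᵥ g ≡ sumᵥ (λ c → g (preimage k false c) + g (preimage k true c))
sumᵥ-preimage (here a) g =
  trans (cong (sumᵥ (g ∘ (false ∷_)) +_) (sym (sumᵥ-shift (g ∘ (true ∷_)) a))) (sym (sumᵥ-+ (g ∘ (false ∷_)) _))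
sumᵥ-preimage (there k) g = cong₂ _+_ (sumᵥ-preimage k (g ∘ (false ∷_))) (sumᵥ-preimage k (g ∘ (true ∷_)))

preimage-surjective : (k : Elimination p) (c : Vec Bool (suc p)) → ∃ λ s → ∃ λ d → c ≡ preimage k s d
preimage-surjective (here a) (false ∷ c) = false , c , refl
preimage-surjective (here a) (true ∷ c) = true , c ⊹ a , cong (true ∷_) (sym (⊹-⊹ c a))
preimage-surjective (there k) (t ∷ c) =
  let s , d , e = preimage-surjective k c in s , t ∷ d , cong (t ∷_) e

fromPreimage : Elimination p → (Bool → Vec Bool p → A) → Vec Bool (suc p) → A
fromPreimage (here a) g (s ∷ c) = g s (if s then c ⊹ a else c)
fromPreimage (there k) g (t ∷ c) = fromPreimage k (λ s d → g s (t ∷ d)) c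

fromPreimage-preimage : (k : Elimination p) (g : Bool → Vec Bool p → A) → ∀ s c →
                        fromPreimage k g (preimage k s c) ≡ g s c
fromPreimage-preimage (here a) g false c = refl
fromPreimage-preimage (here a) g true c = cong (g true) (⊹-⊹ c a)
fromPreimage-preimage (there k) g s (t ∷ c) = fromPreimage-preimage k (λ s d → g s (t ∷ d)) s c

preimage-0̂ : (k : Elimination p) → preimage k false 0̂ ≡ 0̂
preimage-0̂ (here a) = refl
preimage-0̂ (there k) = cong (false ∷_) (preimage-0̂ k)

removeAt : Elimination p → Vec A (suc p) → Vec A p
removeAt (here _) (_ ∷ xs) = xs
removeAt (there k) (x ∷ xs) = x ∷ removeAt k xs

-- The relation is solved for its oldest vector with nonzero coefficient, so that the replacement
-- involves newer vectors only; this keeps the free coordinates of patterns the newest ones.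
leading : (c : Vec Bool (suc p)) → c ≢ 0̂ → Elimination p
leading (true ∷ c) _ = here c
leading {zero} (false ∷ []) c≢ = ⊥-elim (c≢ refl)
leading {suc p} (false ∷ c) c≢ = there (leading c (c≢ ∘ cong (false ∷_)))

leading-preimage : ∀ (c : Vec Bool (suc p)) c≢ (X : Vec (F₂ I) (suc p)) → lin c X ≗ 𝟎 →
                   ∀ s d → lin (preimage (leading c c≢) s d) X ≗ lin d (removeAt (leading c c≢) X)
leading-preimage (true ∷ a) c≢ (x ∷ X) rel false d i = refl
leading-preimage (true ∷ a) c≢ (x ∷ X) rel true d i = begin
  x i xor lin (d ⊹ a) X i          ≡⟨ cong (x i xor_) (lin-⊹ d a X i) ⟩
  x i xor (lin d X i xor lin a X i) ≡⟨ cong₂ _xor_ (xor≡false {x i} (rel i)) (xor-comm (lin d X i) _) ⟩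
  lin a X i xor (lin a X i xor lin d X i) ≡⟨ xor-cancelˡ (lin a X i) _ ⟩
  lin d X i ∎
  where open ≡-Reasoning
leading-preimage {zero} (false ∷ []) c≢ X rel s d i = ⊥-elim (c≢ refl)
leading-preimage {suc p} (false ∷ c) c≢ (x ∷ X) rel s (t ∷ d) i =
  cong ((t ∧ x i) xor_) (leading-preimage c (c≢ ∘ cong (false ∷_)) X rel s d i)

map-removeAt : ∀ {A B : Set} (g : A → B) (k : Elimination p) (xs : Vec A (suc p)) →
               Vec.map g (removeAt k xs) ≡ removeAt k (Vec.map g xs)
map-removeAt g (here _) (_ ∷ xs) = refl
map-removeAt g (there k) (x ∷ xs) = cong (g x ∷_) (map-removeAt g k xs)

-- Patterns

-- A coset in F₂ᵖ: the oldest coordinates are prescribed and the newest ones are free.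
data Pattern : ℕ → Set where
  free : Pattern p
  _∷_  : Bool → Pattern p → Pattern (suc p)

bits : Pattern p → ℕ
bits free = 0
bits (_ ∷ π) = suc (bits π)

bits≤ : (π : Pattern p) → bits π ≤ p
bits≤ free = z≤n
bits≤ (_ ∷ π) = s≤s (bits≤ π)

exact : Vec Bool p → Pattern p
exact [] = free
exact (s ∷ c) = s ∷ exact c

bits-exact : (c : Vec Bool p) → bits (exact c) ≡ p
bits-exact [] = refl
bits-exact (s ∷ c) = cong suc (bits-exact c)

shift : Pattern p → Vec Bool p → Pattern p
shift free a = free
shift (s ∷ π) (t ∷ a) = (s xor t) ∷ shift π a

bits-shift : (π : Pattern p) (a : Vec Bool p) → bits (shift π a) ≡ bits π
bits-shift free a = refl
bits-shift (s ∷ π) (t ∷ a) = cong suc (bits-shift π a)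

shiftIf : Bool → Vec Bool p → Pattern p → Pattern p
shiftIf s a π = if s then shift π a else π

bits-shiftIf : ∀ s (a : Vec Bool p) π → bits (shiftIf s a π) ≡ bits π
bits-shiftIf false a π = refl
bits-shiftIf true a π = bits-shift π a

-- A prescribed coordinate 1 is replaced by `a`, which shifts the coset. A free part that contains
-- the eliminated vector also contains its replacement, so it stays free.
eliminate : Elimination p → Pattern (suc p) → Pattern p
eliminate k free = free
eliminate (here a) (s ∷ π) = shiftIf s a π
eliminate (there k) (s ∷ π) = s ∷ eliminate k π

bits-eliminate : (k : Elimination p) (π : Pattern (suc p)) → bits (eliminate k π) ≤ bits π
bits-eliminate k free = z≤n
bits-eliminate (here a) (s ∷ π) = ≤-trans (≤-reflexive (bits-shiftIf s a π)) (n≤1+n _)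
bits-eliminate (there k) (s ∷ π) = s≤s (bits-eliminate k π)

extend : ∀ n → Pattern p → Pattern (p + n)
extend n free = free
extend n (s ∷ π) = s ∷ extend n π

bits-extend : ∀ n (π : Pattern p) → bits (extend n π) ≡ bits π
bits-extend n free = refl
bits-extend n (s ∷ π) = cong suc (bits-extend n π)

vectors : ∀ p → List (Vec Bool p)
vectors zero = [] ∷ []
vectors (suc p) = map (true ∷_) (vectors p) ++ map (false ∷_) (vectors p)

∈-vectors : (c : Vec Bool p) → c ∈ vectors p
∈-vectors [] = here refl
∈-vectors (true ∷ c) = ∈-++⁺ˡ (∈-map⁺ (true ∷_) (∈-vectors c))
∈-vectors {suc p} (false ∷ c) = ∈-++⁺ʳ (map (true ∷_) (vectors p)) (∈-map⁺ (false ∷_) (∈-vectors c))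

length-vectors : ∀ p → length (vectors p) ≡ 2 ^ p
length-vectors zero = refl
length-vectors (suc p)
  rewrite length-++ (map (true Vec.∷_) (vectors p)) {map (false ∷_) (vectors p)}
        | length-map (true Vec.∷_) (vectors p) | length-map (false Vec.∷_) (vectors p)
        | length-vectors p = cong (2 ^ p +_) (sym (+-identityʳ _))

nonzeros : ∀ p → List (Vec Bool p)
nonzeros zero = []
nonzeros (suc p) = map (true ∷_) (vectors p) ++ map (false ∷_) (nonzeros p)

∈-nonzeros : (c : Vec Bool p) → c ≢ 0̂ → c ∈ nonzeros p
∈-nonzeros [] c≢0 = ⊥-elim (c≢0 refl)
∈-nonzeros (true ∷ c) c≢0 = ∈-++⁺ˡ (∈-map⁺ (true ∷_) (∈-vectors c))
∈-nonzeros {suc p} (false ∷ c) c≢0 =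
  ∈-++⁺ʳ (map (true ∷_) (vectors p)) (∈-map⁺ (false ∷_) (∈-nonzeros c (c≢0 ∘ cong (false ∷_))))

length-nonzeros : ∀ p → suc (length (nonzeros p)) ≡ 2 ^ p
length-nonzeros zero = refl
length-nonzeros (suc p)
  rewrite length-++ (map (true Vec.∷_) (vectors p)) {map (false ∷_) (nonzeros p)}
        | length-map (true Vec.∷_) (vectors p) | length-map (false Vec.∷_) (nonzeros p)
        | length-vectors p =
  trans (sym (+-suc (2 ^ p) _)) (cong (2 ^ p +_) (trans (length-nonzeros p) (sym (+-identityʳ _))))

-- States

-- The block of the oldest coordinate comes first. An entry (s , π) stands for the pattern s ∷ π, so
-- that the pattern prescribes at least the oldest coordinate of its block.
data State : ℕ → Set where
  []  : State 0
  _▹_ : List (Bool × Pattern p) → State p → State (suc p)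

infixr 5 _▹_

nonfree : List (Pattern (suc p)) → List (Bool × Pattern p)
nonfree [] = []
nonfree (free ∷ L) = nonfree L
nonfree ((s ∷ π) ∷ L) = (s , π) ∷ nonfree L

frees : List (Pattern p) → ℕ
frees [] = 0
frees (free ∷ L) = suc (frees L)
frees ((_ ∷ _) ∷ L) = frees L

exact₁ : Vec Bool (suc p) → Bool × Pattern p
exact₁ (s ∷ c) = s , exact c

-- Copies needed per nonzero vector; the successor covers the remainder of the division.
quotient : ∀ p → ℕ → ℕ
quotient p D = suc (D / 2 ^ p)
  where instance _ = m^n≢0 2 p

-- Covers D copies of the whole space, except for the zero vector.
dissolve : ∀ p → ℕ → List (Bool × Pattern p)
dissolve p D = concatMap (λ c → List.replicate (quotient (suc p) D) (exact₁ c)) (nonzeros (suc p))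

-- The block of an eliminated vector passes to the next newer vector. Patterns that have become free
-- are dissolved, the others are kept. If no vector is left, only the zero vector could be demanded,
-- and it needs nothing.
merge : List (Pattern p) → State p → State p
merge L [] = []
merge L (_▹_ {p} qs st) = (dissolve p (frees L) ++ nonfree L ++ qs) ▹ st

eliminateₛ : Elimination p → State (suc p) → State p
eliminateₛ (here a) (ps ▹ st) = merge (map (λ (s , π) → shiftIf s a π) ps) st
eliminateₛ (there k) (ps ▹ st) = map (λ (s , π) → s , eliminate k π) ps ▹ eliminateₛ k st

-- The block of a new vector covers the combinations of new vectors that begin with it, so that
-- together the blocks reach every nonzero combination.
fresh : ∀ n → State n
fresh zero = []
fresh (suc n) = ((true , free) ∷ []) ▹ fresh n

extendₛ : ∀ n → State p → State (p + n)
extendₛ n [] = fresh n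
extendₛ n (ps ▹ st) = map (λ (s , π) → s , extend n π) ps ▹ extendₛ n st

quotient-upper : ∀ p D → 2 ^ p * quotient p D ≤ D + 2 ^ p
quotient-upper p D = begin
  2 ^ p * suc (D / 2 ^ p)        ≡⟨ *-suc (2 ^ p) (D / 2 ^ p) ⟩
  2 ^ p + 2 ^ p * (D / 2 ^ p)    ≡⟨ +-comm (2 ^ p) _ ⟩
  2 ^ p * (D / 2 ^ p) + 2 ^ p    ≡⟨ cong (_+ 2 ^ p) (*-comm (2 ^ p) _) ⟩
  D / 2 ^ p * 2 ^ p + 2 ^ p      ≤⟨ +-monoˡ-≤ (2 ^ p) (m/n*n≤m D (2 ^ p)) ⟩
  D + 2 ^ p                      ∎
  where
  instance _ = m^n≢0 2 p
  open ≤-Reasoning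

quotient-lower : ∀ p D → D ≤ quotient p D * 2 ^ p
quotient-lower p D = begin
  D                                  ≡⟨ m≡m%n+[m/n]*n D (2 ^ p) ⟩
  D % 2 ^ p + D / 2 ^ p * 2 ^ p      ≤⟨ +-monoˡ-≤ _ (<⇒≤ (m%n<n D (2 ^ p))) ⟩
  2 ^ p + D / 2 ^ p * 2 ^ p          ∎
  where
  instance _ = m^n≢0 2 p
  open ≤-Reasoning

-- Demands determined by a state

module Demand (P : ℕ) where

  -- Multiplicity of `c` in a bundle of 2 ^ P vectors: once all p remaining coordinates are free,
  -- each of their 2 ^ p values occurs equally often.
  φ : Pattern p → Vec Bool p → ℕ
  φ {p} free c = 2 ^ (P ∸ p)
  φ (s ∷ π) (t ∷ c) = if s xor t then 0 else φ π c

  φ₁ : Vec Bool (suc p) → Bool × Pattern p → ℕ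
  φ₁ c (s , π) = φ (s ∷ π) c

  -- Patterns of newer blocks have zeros in all older coordinates, hence the cut-off when `t` is
  -- `true`.
  demand : State p → Vec Bool p → ℕ
  demand [] [] = 0
  demand (ps ▹ st) (t ∷ c) = Σₗ (φ₁ (t ∷ c)) ps + (if t then 0 else demand st c)

  φ-shift : (π : Pattern p) (c a : Vec Bool p) → φ π (c ⊹ a) ≡ φ (shift π a) c
  φ-shift free c a = refl
  φ-shift (s ∷ π) (t ∷ c) (u ∷ a) with s | t | u
  ... | false | false | false = φ-shift π c a
  ... | false | false | true  = refl
  ... | false | true  | false = refl
  ... | false | true  | true  = φ-shift π c a
  ... | true  | false | false = refl
  ... | true  | false | true  = φ-shift π c a
  ... | true  | true  | false = φ-shift π c a
  ... | true  | true  | true  = refl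

  double : suc p ≤ P → 2 ^ (P ∸ suc p) + 2 ^ (P ∸ suc p) ≡ 2 ^ (P ∸ p)
  double {p} lt = trans (cong (2 ^ (P ∸ suc p) +_) (sym (+-identityʳ _))) (cong (2 ^_) (suc-∸ lt))
    where
    suc-∸ : ∀ {p P} → suc p ≤ P → suc (P ∸ suc p) ≡ P ∸ p
    suc-∸ {p} (s≤s le) = sym (+-∸-assoc 1 le)

  -- A uniform bundle has a uniform image: if the eliminated coordinate is free, both vectors over
  -- `c` contribute equally; if it is prescribed, at most one of them contributes.
  φ-eliminate : suc p ≤ P → (k : Elimination p) (π : Pattern (suc p)) (c : Vec Bool p) →
                φ π (preimage k false c) + φ π (preimage k true c) ≡ φ (eliminate k π) c
  φ-eliminate lt k free c = double lt
  φ-eliminate lt (here a) (false ∷ π) c = +-identityʳ _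
  φ-eliminate lt (here a) (true ∷ π) c = φ-shift π c a
  φ-eliminate lt (there k) (false ∷ π) (false ∷ c) = φ-eliminate (<⇒≤ lt) k π c
  φ-eliminate lt (there k) (false ∷ π) (true ∷ c) = refl
  φ-eliminate lt (there k) (true ∷ π) (false ∷ c) = refl
  φ-eliminate lt (there k) (true ∷ π) (true ∷ c) = φ-eliminate (<⇒≤ lt) k π c

  φ-exact : (c : Vec Bool p) → φ (exact c) c ≡ 2 ^ P
  φ-exact [] = refl
  φ-exact (false ∷ c) = φ-exact c
  φ-exact (true ∷ c) = φ-exact c

  -- The multiplicity 2 ^ (P - p) of a free part divides evenly among the 2 ^ n extensions because p
  -- + n is at most P.
  φ-extend : ∀ n → p + n ≤ P → (π : Pattern p) (c : Vec Bool p) →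
             sumᵥ (λ s → φ (extend n π) (c Vec.++ s)) ≡ φ π c
  φ-extend {p} n le free c = begin
    sumᵥ {n} (λ _ → 2 ^ (P ∸ (p + n)))  ≡⟨ sumᵥ-const n _ ⟩
    2 ^ n * 2 ^ (P ∸ (p + n))           ≡⟨ ^-distribˡ-+-* 2 n (P ∸ (p + n)) ⟨
    2 ^ (n + (P ∸ (p + n)))             ≡⟨ cong (λ k → 2 ^ (n + k)) (∸-+-assoc P p n) ⟨
    2 ^ (n + (P ∸ p ∸ n))               ≡⟨ cong (2 ^_) (m+[n∸m]≡n (m+n≤o⇒n≤o∸m p le)) ⟩
    2 ^ (P ∸ p)                         ∎
    where
    open ≡-Reasoning
  φ-extend n le (false ∷ π) (false ∷ c) = φ-extend n (<⇒≤ le) π c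
  φ-extend n le (false ∷ π) (true ∷ c) = sumᵥ-0 n
  φ-extend n le (true ∷ π) (false ∷ c) = sumᵥ-0 n
  φ-extend n le (true ∷ π) (true ∷ c) = φ-extend n (<⇒≤ le) π c

  φ-total : (π : Pattern p) → p ≤ P → sumᵥ (φ π) ≤ 2 ^ P
  φ-total {p} free le = ≤-reflexive (trans (sumᵥ-const p _) (trans (sym (^-distribˡ-+-* 2 p (P ∸ p))) (cong (2 ^_) (m+[n∸m]≡n le))))
  φ-total {suc p} (false ∷ π) le rewrite sumᵥ-0 p | +-identityʳ (sumᵥ (φ π)) = φ-total π (<⇒≤ le)
  φ-total {suc p} (true ∷ π) le rewrite sumᵥ-0 p = φ-total π (<⇒≤ le)

  split-free : (L : List (Pattern (suc p))) (c : Vec Bool (suc p)) →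
               Σₗ (λ π → φ π c) L ≡ frees L * 2 ^ (P ∸ suc p) + Σₗ (φ₁ c) (nonfree L)
  split-free [] c = refl
  split-free {p} (free ∷ L) c = trans (cong (2 ^ (P ∸ suc p) +_) (split-free L c)) (sym (+-assoc (2 ^ (P ∸ suc p)) _ _))
  split-free {p} ((s ∷ π) ∷ L) c = trans (cong (φ (s ∷ π) c +_) (split-free L c)) (x+[y+z] (φ (s ∷ π) c) (frees L * 2 ^ (P ∸ suc p)) _)
    where
    x+[y+z] : ∀ x y z → x + (y + z) ≡ y + (x + z)
    x+[y+z] x y z = trans (sym (+-assoc x y z)) (trans (cong (_+ z) (+-comm x y)) (+-assoc y x z))

  φ₁-exact : (c : Vec Bool (suc p)) → φ₁ c (exact₁ c) ≡ 2 ^ P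
  φ₁-exact c@(_ ∷ _) = φ-exact c

  -- An exact bundle supplies 2 ^ P at a single vector, whereas a free one asks for only 2 ^ (P -
  -- suc p) there; so one exact bundle per vector replaces 2 ^ suc p free ones.
  dissolve-demand : suc p ≤ P → ∀ D (c : Vec Bool (suc p)) → c ≢ 0̂ →
                    D * 2 ^ (P ∸ suc p) ≤ Σₗ (φ₁ c) (dissolve p D)
  dissolve-demand {p} le D c c≢0 = begin
    D * 2 ^ (P ∸ suc p)                          ≤⟨ *-monoˡ-≤ (2 ^ (P ∸ suc p)) (quotient-lower (suc p) D) ⟩
    d * 2 ^ suc p * 2 ^ (P ∸ suc p)              ≡⟨ *-assoc d (2 ^ suc p) _ ⟩
    d * (2 ^ suc p * 2 ^ (P ∸ suc p))            ≡⟨ cong (d *_) (^-distribˡ-+-* 2 (suc p) (P ∸ suc p)) ⟨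
    d * 2 ^ (suc p + (P ∸ suc p))                ≡⟨ cong (λ k → d * 2 ^ k) (m+[n∸m]≡n le) ⟩
    d * 2 ^ P                                    ≡⟨ cong (d *_) (φ₁-exact c) ⟨
    d * φ₁ c (exact₁ c)                          ≡⟨ Σₗ-replicate (φ₁ c) d (exact₁ c) ⟨
    Σₗ (φ₁ c) (List.replicate d (exact₁ c))      ≤⟨ Σₗ-∈ _ (∈-nonzeros c c≢0) ⟩
    Σₗ (λ v → Σₗ (φ₁ c) (List.replicate d (exact₁ v))) (nonzeros (suc p)) ≡⟨ Σₗ-concatMap (φ₁ c) _ (nonzeros (suc p)) ⟨
    Σₗ (φ₁ c) (dissolve p D)                     ∎
    where
    d = quotient (suc p) D
    open ≤-Reasoning

  merge-demand : p ≤ P → (L : List (Pattern p)) (st : State p) (c : Vec Bool p) → c ≢ 0̂ →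
                 Σₗ (λ π → φ π c) L + demand st c ≤ demand (merge L st) c
  merge-demand le L [] [] c≢0 = ⊥-elim (c≢0 refl)
  merge-demand le L (_▹_ {p} qs st) c@(t ∷ c′) c≢0 = begin
    Σₗ (λ π → φ π c) L + (Q + rest)        ≡⟨ cong (_+ (Q + rest)) (split-free L c) ⟩
    (D + F) + (Q + rest)                   ≤⟨ +-monoˡ-≤ (Q + rest) (+-monoˡ-≤ F (dissolve-demand le (frees L) c c≢0)) ⟩
    (D′ + F) + (Q + rest)                  ≡⟨ +-assoc (D′ + F) Q rest ⟨
    ((D′ + F) + Q) + rest                  ≡⟨ cong (_+ rest) (+-assoc D′ F Q) ⟩
    (D′ + (F + Q)) + rest                  ≡⟨ cong (λ k → (D′ + k) + rest) (Σₗ-++ (φ₁ c) (nonfree L) qs) ⟨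
    (D′ + Σₗ (φ₁ c) (nonfree L ++ qs)) + rest ≡⟨ cong (_+ rest) (Σₗ-++ (φ₁ c) (dissolve p (frees L)) _) ⟨
    demand (merge L (qs ▹ st)) c           ∎
    where
    D = frees L * 2 ^ (P ∸ suc p)
    D′ = Σₗ (φ₁ c) (dissolve p (frees L))
    F = Σₗ (φ₁ c) (nonfree L)
    Q = Σₗ (φ₁ c) qs
    rest = if t then 0 else demand st c′
    open ≤-Reasoning

  -- Both vectors over `c` get the same boundary, so their demands are added. The exclusion of `0̂`
  -- is what lets dissolved bundles skip the zero vector.
  eliminate-demand : suc p ≤ P → (k : Elimination p) (st : State (suc p)) (c : Vec Bool p) → c ≢ 0̂ →
                     demand st (preimage k false c) + demand st (preimage k true c) ≤ demand (eliminateₛ k st) c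
  eliminate-demand lt (here a) (ps ▹ st) c c≢0 = begin
    (F + demand st c) + (T + 0)          ≡⟨ cong ((F + demand st c) +_) (+-identityʳ T) ⟩
    (F + demand st c) + T                ≡⟨ trans (+-assoc F _ T) (trans (cong (F +_) (+-comm _ T)) (sym (+-assoc F T _))) ⟩
    (F + T) + demand st c                ≡⟨ cong (_+ demand st c) (trans (sym (Σₗ-+ _ _ ps))
                                              (trans (Σₗ-cong (λ (s , π) → φ-eliminate lt (here a) (s ∷ π) c) ps)
                                                     (sym (Σₗ-map (λ π → φ π c) _ ps)))) ⟩
    Σₗ (λ π → φ π c) (map (λ (s , π) → shiftIf s a π) ps) + demand st c ≤⟨ merge-demand (<⇒≤ lt) _ st c c≢0 ⟩
    demand (eliminateₛ (here a) (ps ▹ st)) c ∎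
    where
    F = Σₗ (φ₁ (false ∷ c)) ps
    T = Σₗ (φ₁ (true ∷ (c ⊹ a))) ps
    open ≤-Reasoning
  eliminate-demand lt (there k) (ps ▹ st) (t ∷ c) c≢0 = begin
    (F + f) + (T + g)   ≡⟨ +-interchange F f T g ⟩
    (F + T) + (f + g)   ≤⟨ +-mono-≤ (≤-reflexive patterns) (rest t c≢0) ⟩
    demand (eliminateₛ (there k) (ps ▹ st)) (t ∷ c) ∎
    where
    F = Σₗ (φ₁ (t ∷ preimage k false c)) ps
    T = Σₗ (φ₁ (t ∷ preimage k true c)) ps
    f = if t then 0 else demand st (preimage k false c)
    g = if t then 0 else demand st (preimage k true c)
    patterns : F + T ≡ Σₗ (φ₁ (t ∷ c)) (map (λ (s , π) → s , eliminate k π) ps)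
    patterns = trans (sym (Σₗ-+ _ _ ps))
               (trans (Σₗ-cong (λ (s , π) → φ-eliminate lt (there k) (s ∷ π) (t ∷ c)) ps)
                      (sym (Σₗ-map (φ₁ (t ∷ c)) _ ps)))
    rest : ∀ t → t ∷ c ≢ 0̂ →
           (if t then 0 else demand st (preimage k false c)) + (if t then 0 else demand st (preimage k true c)) ≤ (if t then 0 else demand (eliminateₛ k st) c)
    rest true _ = z≤n
    rest false c≢0 = eliminate-demand (<⇒≤ lt) k st c (c≢0 ∘ cong (false ∷_))
    open ≤-Reasoning

  fresh-demand : ∀ {n} (s : Vec Bool n) → s ≢ 0̂ → 1 ≤ demand (fresh n) s
  fresh-demand [] s≢0 = ⊥-elim (s≢0 refl)
  fresh-demand {suc n} (false ∷ s) s≢0 = fresh-demand s (s≢0 ∘ cong (false ∷_))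
  fresh-demand {suc n} (true ∷ s) s≢0 = ≤-trans (m^n>0 2 (P ∸ n)) (≤-trans (m≤m+n _ 0) (m≤m+n _ 0))

  extend-demand : ∀ n → p + n ≤ P → (st : State p) (c : Vec Bool p) →
                  demand st c ≤ sumᵥ (λ s → demand (extendₛ n st) (c Vec.++ s))
  extend-demand n le [] [] = z≤n
  extend-demand n le (ps ▹ st) (t ∷ c) = begin
    Σₗ (φ₁ (t ∷ c)) ps + (if t then 0 else demand st c)
      ≤⟨ +-mono-≤ (≤-reflexive patterns) (rest t) ⟩
    sumᵥ (λ s → Σₗ (φ₁ (t ∷ c Vec.++ s)) ps′) + sumᵥ (λ s → if t then 0 else demand (extendₛ n st) (c Vec.++ s))
      ≡⟨ sumᵥ-+ {n} _ _ ⟨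
    sumᵥ (λ s → demand (extendₛ n (ps ▹ st)) (t ∷ c Vec.++ s)) ∎
    where
    open ≤-Reasoning
    ps′ = map (λ (s , π) → s , extend n π) ps
    patterns : Σₗ (φ₁ (t ∷ c)) ps ≡ sumᵥ (λ s → Σₗ (φ₁ (t ∷ c Vec.++ s)) ps′)
    patterns = trans (Σₗ-cong (λ (s , π) → sym (φ-extend n le (s ∷ π) (t ∷ c))) ps)
               (trans (sym (sumᵥ-Σₗ {p = n} _ ps)) (sumᵥ-cong {n} λ s → sym (Σₗ-map (φ₁ (t ∷ c Vec.++ s)) _ ps)))
    rest : ∀ t → (if t then 0 else demand st c) ≤ sumᵥ (λ s → if t then 0 else demand (extendₛ n st) (c Vec.++ s))
    rest true = z≤n
    rest false = extend-demand n (<⇒≤ le) st c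

  extend-fresh : ∀ {n} (st : State p) (s : Vec Bool n) → s ≢ 0̂ → 1 ≤ demand (extendₛ n st) (0̂ {p} Vec.++ s)
  extend-fresh [] s s≢0 = fresh-demand s s≢0
  extend-fresh (ps ▹ st) s s≢0 = ≤-trans (extend-fresh st s s≢0) (m≤n+m _ _)

  -- Weights

  -- Large enough that (2 ^ q - 1) * q is at most `Ω` for all q up to P: omitting the zero vector
  -- then pays for the coordinates that dissolving prescribes.
  Ω : ℕ
  Ω = P * 2 ^ P

  weight : Bool × Pattern p → ℕ
  weight (_ , π) = Ω + suc (bits π)

  maxWeight : ℕ
  maxWeight = Ω + suc P

  -- The rounding loss of `dissolve-weight`, plus one so that a fresh block always fits.
  slack : ℕ
  slack = suc (Ω * 2 ^ P)

  -- Dictated by `merge-valid`: with κ the slack plus the capacity of the next block, a block of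
  -- weight up to `maxWeight * κ` must still be able to grow by κ.
  capacity : ℕ → ℕ
  capacity zero = 0
  capacity (suc β) = suc maxWeight * (slack + capacity β)

  loadBound : ℕ
  loadBound = 2 ^ P * (P * capacity P)

  -- Blocks are bounded in terms of their distance β from the newest position that a block can have.
  Valid : ℕ → State p → Set
  Valid β [] = ⊤
  Valid zero (_ ▹ _) = ⊥
  Valid (suc β) (ps ▹ st) = Σₗ weight ps ≤ capacity (suc β) × Valid β st

  capacity-mono : ∀ β → capacity β ≤ capacity (suc β)
  capacity-mono β = ≤-trans (m≤n+m (capacity β) slack) (m≤m+n _ _)

  -- Used for the blocks newer than a merged one, which move one place away from the newest
  -- position.
  Valid-suc : ∀ β (st : State p) → Valid β st → Valid (suc β) st
  Valid-suc β [] v = tt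
  Valid-suc (suc β) (ps ▹ st) (w , v) = ≤-trans w (capacity-mono (suc β)) , Valid-suc β st v

  -- A bundle contributes at most 2 ^ P, and since weights are positive there are at most as many
  -- bundles in a block as units of weight.
  total-demand : ∀ β (st : State p) → p ≤ P → Valid β st → sumᵥ (demand st) ≤ 2 ^ P * (β * capacity β)
  total-demand β [] le v = z≤n
  total-demand {suc p} (suc β) (ps ▹ st) le (w , v) = begin
    sumᵥ (demand (ps ▹ st) ∘ (false ∷_)) + sumᵥ (demand (ps ▹ st) ∘ (true ∷_))
      ≡⟨ cong₂ _+_ (sumᵥ-+ {p} _ (demand st)) (trans (sumᵥ-+ {p} _ (λ _ → 0)) (cong (T +_) (sumᵥ-0 p))) ⟩
    (F + S) + (T + 0)                   ≡⟨ rearrange F S T ⟩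
    (F + T) + S                         ≤⟨ +-mono-≤ block (≤-trans (total-demand β st (<⇒≤ le) v)
                                             (*-monoʳ-≤ (2 ^ P) (*-monoʳ-≤ β (capacity-mono β)))) ⟩
    2 ^ P * capacity (suc β) + 2 ^ P * (β * capacity (suc β))   ≡⟨ *-distribˡ-+ (2 ^ P) _ _ ⟨
    2 ^ P * (suc β * capacity (suc β))  ∎
    where
    open ≤-Reasoning
    F = sumᵥ (λ c → Σₗ (φ₁ (false ∷ c)) ps)
    T = sumᵥ (λ c → Σₗ (φ₁ (true ∷ c)) ps)
    S = sumᵥ (demand st)
    rearrange : ∀ F S T → (F + S) + (T + 0) ≡ (F + T) + S
    rearrange = solve 3 (λ F S T → (F :+ S) :+ (T :+ con 0) := (F :+ T) :+ S) refl
      where open +-*-Solver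
    block : F + T ≤ 2 ^ P * capacity (suc β)
    block = begin
      sumᵥ (λ c → Σₗ (φ₁ c) ps)          ≡⟨ sumᵥ-Σₗ (λ x c → φ₁ c x) ps ⟩
      Σₗ (λ x → sumᵥ (λ c → φ₁ c x)) ps  ≤⟨ Σₗ-mono (λ (s , π) → φ-total (s ∷ π) le) ps ⟩
      Σₗ (λ _ → 2 ^ P) ps                ≡⟨ Σₗ-const (λ _ → refl) ps ⟩
      length ps * 2 ^ P                  ≡⟨ *-comm (length ps) _ ⟩
      2 ^ P * length ps                  ≤⟨ *-monoʳ-≤ (2 ^ P) (≤-trans length≤ w) ⟩
      2 ^ P * capacity (suc β)           ∎
      where
      length≤ : length ps ≤ Σₗ weight ps
      length≤ = begin
        length ps            ≡⟨ *-identityʳ _ ⟨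
        length ps * 1        ≡⟨ Σₗ-const (λ _ → refl) ps ⟨
        Σₗ (λ _ → 1) ps      ≤⟨ Σₗ-mono (λ (_ , π) → ≤-trans (s≤s z≤n) (m≤n+m (suc (bits π)) Ω)) ps ⟩
        Σₗ weight ps         ∎

  fresh-valid : ∀ β n → n ≤ β → Valid β (fresh n)
  fresh-valid β zero le = tt
  fresh-valid (suc β) (suc n) (s≤s le) = bound , fresh-valid β n le
    where
    bound : Ω + 1 + 0 ≤ capacity (suc β)
    bound = begin
      Ω + 1 + 0                              ≡⟨ +-identityʳ _ ⟩
      Ω + 1                                  ≤⟨ +-monoʳ-≤ Ω (s≤s z≤n) ⟩
      maxWeight                              ≤⟨ n≤1+n _ ⟩
      suc maxWeight                          ≡⟨ *-identityʳ _ ⟨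
      suc maxWeight * 1                      ≤⟨ *-monoʳ-≤ (suc maxWeight) {1} {slack + capacity β} (s≤s z≤n) ⟩
      suc maxWeight * (slack + capacity β)   ∎
      where open ≤-Reasoning

  extend-valid : ∀ β n (st : State p) → p + n ≤ β → Valid β st → Valid β (extendₛ n st)
  extend-valid β n [] le v = fresh-valid β n le
  extend-valid (suc β) n (ps ▹ st) (s≤s le) (w , v) =
    ≤-trans (≤-reflexive (trans (Σₗ-map weight _ ps) (Σₗ-cong (λ (_ , π) → cong (λ k → Ω + suc k) (bits-extend n π)) ps))) w ,
    extend-valid β n st le v

  -- The 2 ^ suc p - 1 exact patterns of one round together weigh at most 2 ^ suc p times `Ω`. Thus
  -- each free bundle costs `Ω`, up to rounding.
  dissolve-weight : suc p ≤ P → ∀ D → Σₗ weight (dissolve p D) ≤ Ω * D + Ω * 2 ^ P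
  dissolve-weight {p} le D = begin
    Σₗ weight (dissolve p D)             ≡⟨ Σₗ-concatMap weight _ (nonzeros (suc p)) ⟩
    Σₗ (λ c → Σₗ weight (List.replicate d (exact₁ c))) (nonzeros (suc p))
      ≡⟨ Σₗ-const (λ { c@(_ ∷ c′) → trans (Σₗ-replicate weight d (exact₁ c)) (cong (λ k → d * (Ω + suc k)) (bits-exact c′)) }) (nonzeros (suc p)) ⟩
    N * (d * (Ω + suc p))                ≡⟨ rearrange N d Ω (suc p) ⟩
    d * (N * Ω + N * suc p)              ≤⟨ *-monoʳ-≤ d (+-monoʳ-≤ (N * Ω) N*≤) ⟩
    d * (N * Ω + Ω)                      ≡⟨ cong (d *_) (+-comm (N * Ω) Ω) ⟩
    d * (suc N * Ω)                      ≡⟨ cong (λ k → d * (k * Ω)) (length-nonzeros (suc p)) ⟩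
    d * (2 ^ suc p * Ω)                  ≡⟨ rearrange′ d (2 ^ suc p) Ω ⟩
    Ω * (2 ^ suc p * d)                  ≤⟨ *-monoʳ-≤ Ω (quotient-upper (suc p) D) ⟩
    Ω * (D + 2 ^ suc p)                  ≤⟨ *-monoʳ-≤ Ω (+-monoʳ-≤ D (^-monoʳ-≤ 2 le)) ⟩
    Ω * (D + 2 ^ P)                      ≡⟨ *-distribˡ-+ Ω D _ ⟩
    Ω * D + Ω * 2 ^ P                    ∎
    where
    open ≤-Reasoning
    d = quotient (suc p) D
    N = length (nonzeros (suc p))
    N*≤ : N * suc p ≤ Ω
    N*≤ = ≤-trans (*-mono-≤ (≤-trans (≤-trans (n≤1+n N) (≤-reflexive (length-nonzeros (suc p)))) (^-monoʳ-≤ 2 le)) le)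
                  (≤-reflexive (*-comm (2 ^ P) P))
    rearrange : ∀ N d w k → N * (d * (w + k)) ≡ d * (N * w + N * k)
    rearrange = solve 4 (λ N d w k → N :* (d :* (w :+ k)) := d :* (N :* w :+ N :* k)) refl
      where open +-*-Solver
    rearrange′ : ∀ d a w → d * (a * w) ≡ w * (a * d)
    rearrange′ = solve 3 (λ d a w → d :* (a :* w) := w :* (a :* d)) refl
      where open +-*-Solver

  -- Every pattern loses one unit of weight when its block merges with the next one, also when it dissolves.
  merge-weight : (L : List (Pattern (suc p))) →
                 Ω * frees L + Σₗ weight (nonfree L) + length L ≡ Σₗ (λ π → Ω + suc (bits π)) L
  merge-weight [] = cong (λ k → k + 0 + 0) (*-zeroʳ Ω)
  merge-weight (free ∷ L) = trans (rearrange Ω (frees L) _ _) (cong (Ω + 1 +_) (merge-weight L))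
    where
    rearrange : ∀ w f a l → w * suc f + a + suc l ≡ w + 1 + (w * f + a + l)
    rearrange = solve 4 (λ w f a l → w :* (con 1 :+ f) :+ a :+ (con 1 :+ l) := w :+ con 1 :+ (w :* f :+ a :+ l)) refl
      where open +-*-Solver
  merge-weight ((s ∷ π) ∷ L) = trans (rearrange Ω (bits π) (Ω * frees L) _ _) (cong (Ω + suc (suc (bits π)) +_) (merge-weight L))
    where
    rearrange : ∀ w b f a l → f + (w + suc b + a) + suc l ≡ w + suc (suc b) + (f + a + l)
    rearrange = solve 5 (λ w b f a l → f :+ (w :+ (con 1 :+ b) :+ a) :+ (con 1 :+ l) := w :+ (con 2 :+ b) :+ (f :+ a :+ l)) refl
      where open +-*-Solver

  -- Merging adds at most κ but releases one unit per pattern of `L`. If `L` has at least κ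
  -- patterns, the gain covers the cost; otherwise `L` is so short that its maximal weight plus κ
  -- fits.
  merge-valid : ∀ β → p ≤ P → (L : List (Pattern p)) (st : State p) →
                Σₗ (λ π → Ω + suc (bits π)) L ≤ capacity (suc β) → Valid β st → Valid (suc β) (merge L st)
  merge-valid β le L [] w v = tt
  merge-valid {suc p} (suc β) le L (qs ▹ st) w (w′ , v) = bound , Valid-suc β st v
    where
    open ≤-Reasoning
    W = Σₗ (λ π → Ω + suc (bits π)) L
    new = Σₗ weight (dissolve p (frees L) ++ nonfree L ++ qs)
    κ = slack + capacity (suc β)
    small : new + length L ≤ W + κ
    small = begin
      new + length L
        ≡⟨ cong (_+ length L) (trans (Σₗ-++ weight (dissolve p (frees L)) _)
             (cong (Σₗ weight (dissolve p (frees L)) +_) (Σₗ-++ weight (nonfree L) qs))) ⟩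
      Σₗ weight (dissolve p (frees L)) + (Σₗ weight (nonfree L) + Σₗ weight qs) + length L
        ≤⟨ +-monoˡ-≤ (length L) (+-mono-≤ (dissolve-weight le (frees L)) (+-monoʳ-≤ (Σₗ weight (nonfree L)) w′)) ⟩
      (Ω * frees L + Ω * 2 ^ P) + (Σₗ weight (nonfree L) + capacity (suc β)) + length L
        ≡⟨ rearrange (Ω * frees L) (Ω * 2 ^ P) _ (capacity (suc β)) (length L) ⟩
      (Ω * frees L + Σₗ weight (nonfree L) + length L) + (Ω * 2 ^ P + capacity (suc β))
        ≤⟨ +-mono-≤ (≤-reflexive (merge-weight L)) (n≤1+n _) ⟩
      W + κ ∎
      where
      rearrange : ∀ a b c d l → (a + b) + (c + d) + l ≡ (a + c + l) + (b + d)
      rearrange = solve 5 (λ a b c d l → (a :+ b) :+ (c :+ d) :+ l := (a :+ c :+ l) :+ (b :+ d)) refl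
        where open +-*-Solver
    bound : new ≤ capacity (suc (suc β))
    bound with κ ≤? length L
    ... | yes κ≤ = +-cancelʳ-≤ κ new _ (begin
      new + κ             ≤⟨ +-monoʳ-≤ new κ≤ ⟩
      new + length L      ≤⟨ small ⟩
      W + κ               ≤⟨ +-monoˡ-≤ κ w ⟩
      capacity (suc (suc β)) + κ ∎)
    ... | no κ≰ = begin
      new                            ≤⟨ m≤m+n new _ ⟩
      new + length L                 ≤⟨ small ⟩
      W + κ                          ≤⟨ +-monoˡ-≤ κ (Σₗ-mono (λ π → +-monoʳ-≤ Ω (s≤s (≤-trans (bits≤ π) le))) L) ⟩
      Σₗ (λ _ → maxWeight) L + κ     ≡⟨ cong (_+ κ) (trans (Σₗ-const (λ _ → refl) L) (*-comm (length L) maxWeight)) ⟩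
      maxWeight * length L + κ       ≤⟨ +-monoˡ-≤ κ (*-monoʳ-≤ maxWeight (<⇒≤ (≰⇒> κ≰))) ⟩
      maxWeight * κ + κ              ≡⟨ +-comm (maxWeight * κ) κ ⟩
      suc maxWeight * κ              ∎

  eliminate-valid : ∀ β → suc p ≤ P → (k : Elimination p) (st : State (suc p)) →
                    Valid β st → Valid β (eliminateₛ k st)
  eliminate-valid (suc β) le (here a) (ps ▹ st) (w , v) =
    merge-valid β (<⇒≤ le) _ st
      (≤-trans (≤-reflexive (trans (Σₗ-map _ _ ps) (Σₗ-cong (λ (s , π) → cong (λ k → Ω + suc k) (bits-shiftIf s a π)) ps))) w) v
  eliminate-valid (suc β) le (there k) (ps ▹ st) (w , v) =
    ≤-trans (≤-trans (≤-reflexive (Σₗ-map weight _ ps)) (Σₗ-mono (λ (_ , π) → +-monoʳ-≤ Ω (s≤s (bits-eliminate k π))) ps)) w ,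
    eliminate-valid β (<⇒≤ le) k st v

-- Sums over all vectors, and congestion of lists

Σₗ-vectors : (g : Vec Bool p → ℕ) → Σₗ g (vectors p) ≡ sumᵥ g
Σₗ-vectors {zero} g = +-identityʳ (g [])
Σₗ-vectors {suc p} g = begin
  Σₗ g (map (true ∷_) (vectors p) ++ map (false ∷_) (vectors p))
    ≡⟨ Σₗ-++ g (map (true ∷_) (vectors p)) _ ⟩
  Σₗ g (map (true ∷_) (vectors p)) + Σₗ g (map (false ∷_) (vectors p))
    ≡⟨ cong₂ _+_ (trans (Σₗ-map g _ (vectors p)) (Σₗ-vectors (g ∘ (true ∷_))))
                 (trans (Σₗ-map g _ (vectors p)) (Σₗ-vectors (g ∘ (false ∷_)))) ⟩
  sumᵥ (g ∘ (true ∷_)) + sumᵥ (g ∘ (false ∷_))  ≡⟨ +-comm (sumᵥ (g ∘ (true ∷_))) _ ⟩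
  sumᵥ g ∎
  where open ≡-Reasoning

length-concatMap : (f : I → List A) (L : List I) → length (concatMap f L) ≡ Σₗ (length ∘ f) L
length-concatMap f [] = refl
length-concatMap f (x ∷ L) = trans (length-++ (f x)) (cong (length (f x) +_) (length-concatMap f L))

-- Lets the lifts of the zero vector be counted as new cycles instead of as lifts.
sumᵥ-without-0̂ : (g g′ : Vec Bool p → ℕ) → (∀ c → g′ c ≤ g c) → g′ 0̂ ≡ 0 → sumᵥ g′ + g 0̂ ≤ sumᵥ g
sumᵥ-without-0̂ {zero} g g′ le eq rewrite eq = ≤-refl
sumᵥ-without-0̂ {suc p} g g′ le eq = begin
  (F′ + T′) + g 0̂  ≡⟨ trans (+-assoc F′ T′ _) (trans (cong (F′ +_) (+-comm T′ _)) (sym (+-assoc F′ _ T′))) ⟩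
  (F′ + g 0̂) + T′  ≤⟨ +-mono-≤ (sumᵥ-without-0̂ (g ∘ (false ∷_)) (g′ ∘ (false ∷_)) (le ∘ (false ∷_)) eq) (sumᵥ-mono (le ∘ (true ∷_))) ⟩
  sumᵥ g           ∎
  where
  open ≤-Reasoning
  F′ = sumᵥ (g′ ∘ (false ∷_))
  T′ = sumᵥ (g′ ∘ (true ∷_))

congestionAt : List (F₂ I) → I → ℕ
congestionAt L i = Σₗ (λ X → if X i then 1 else 0) L

congestionAt-take-drop : ∀ m (L : List (F₂ I)) i → congestionAt (take m L) i + congestionAt (drop m L) i ≡ congestionAt L i
congestionAt-take-drop m L i = trans (sym (Σₗ-++ _ (take m L) (drop m L))) (cong (λ L → congestionAt L i) (take++drop≡id m L))

congestionAt-replicate-𝟎 : ∀ m (i : I) → congestionAt (List.replicate m 𝟎) i ≡ 0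
congestionAt-replicate-𝟎 m i = trans (Σₗ-replicate _ m 𝟎) (*-zeroʳ m)

-- Edge-labelled trees

data Tree (E : Set) : Set where
  nil  : Tree E
  leaf : E → Tree E
  node : Tree E → Tree E → Tree E

Pos : Tree E → Set
Pos nil = ⊥
Pos (leaf e) = ⊤
Pos (node l r) = Pos l ⊎ Pos r

label : (t : Tree E) → Pos t → E
label (leaf e) _ = e
label (node l r) (inj₁ i) = label l i
label (node l r) (inj₂ i) = label r i

glue : {l r : Tree E} → F₂ (Pos l) → F₂ (Pos r) → F₂ (Pos (node l r))
glue = [_,_]′

subsets : (t : Tree E) → List (F₂ (Pos t))
subsets nil = 𝟎 ∷ []
subsets (leaf e) = (λ _ → true) ∷ 𝟎 ∷ []
subsets (node l r) = cartesianProductWith (glue {l = l} {r = r}) (subsets l) (subsets r)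

subsets-complete : (t : Tree E) (X : F₂ (Pos t)) → ∃ λ Y → Y ∈ subsets t × X ≗ Y
subsets-complete nil X = 𝟎 , here refl , λ ()
subsets-complete (leaf e) X with X tt in eq
... | true = _ , here refl , λ _ → eq
... | false = _ , there (here refl) , λ _ → eq
subsets-complete (node l r) X =
  let Y , Y∈ , X≗Y = subsets-complete l (X ∘ inj₁)
      Z , Z∈ , X≗Z = subsets-complete r (X ∘ inj₂)
  in glue Y Z , ∈-cartesianProductWith⁺ (glue {l = l} {r = r}) Y∈ Z∈ , λ { (inj₁ i) → X≗Y i ; (inj₂ i) → X≗Z i }

-- Boundary maps

module Boundary {E : Set} {n : ℕ} (h : E → F₂ (Fin n)) where

  ∂ : (t : Tree E) → F₂ (Pos t) → F₂ (Fin n)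
  ∂ nil X = 𝟎
  ∂ (leaf e) X = X tt ⊙ h e
  ∂ (node l r) X = ∂ l (X ∘ inj₁) ⊞ ∂ r (X ∘ inj₂)

  ∂-cong : ∀ t {X Y} → X ≗ Y → ∂ t X ≗ ∂ t Y
  ∂-cong nil eq v = refl
  ∂-cong (leaf e) eq v = cong (_∧ h e v) (eq tt)
  ∂-cong (node l r) eq v = cong₂ _xor_ (∂-cong l (eq ∘ inj₁) v) (∂-cong r (eq ∘ inj₂) v)

  ∂-⊞ : ∀ t X Y → ∂ t (X ⊞ Y) ≗ ∂ t X ⊞ ∂ t Y
  ∂-⊞ nil X Y v = refl
  ∂-⊞ (leaf e) X Y v = Bool.∧-distribʳ-xor (h e v) (X tt) (Y tt)
  ∂-⊞ (node l r) X Y v =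
    trans (cong₂ _xor_ (∂-⊞ l (X ∘ inj₁) (Y ∘ inj₁) v) (∂-⊞ r (X ∘ inj₂) (Y ∘ inj₂) v))
          (xor-interchange (∂ l (X ∘ inj₁) v) _ _ _)

  ∂-𝟎 : ∀ t → ∂ t 𝟎 ≗ 𝟎
  ∂-𝟎 nil v = refl
  ∂-𝟎 (leaf e) v = refl
  ∂-𝟎 (node l r) v = cong₂ _xor_ (∂-𝟎 l v) (∂-𝟎 r v)

  ∂-⊙ : ∀ t s X → ∂ t (s ⊙ X) ≗ s ⊙ ∂ t X
  ∂-⊙ t false X = ∂-𝟎 t
  ∂-⊙ t true X v = refl

  ∂-lin : ∀ t (c : Vec Bool p) Y → ∂ t (lin c Y) ≗ lin c (Vec.map (∂ t) Y)
  ∂-lin t [] [] v = ∂-𝟎 t v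
  ∂-lin t (s ∷ c) (y ∷ Y) v =
    trans (∂-⊞ t (s ⊙ y) (lin c Y) v) (cong₂ _xor_ (∂-⊙ t s y v) (∂-lin t c Y v))

  ∂-lin-linear : ∀ t (Y : Vec (F₂ (Pos t)) p) → Linear (λ c → ∂ t (lin c Y))
  ∂-lin-linear t Y c d v = trans (∂-cong t (lin-⊹ c d Y) v) (∂-⊞ t (lin c Y) (lin d Y) v)

  Untouched : Tree E → Fin n → Set
  Untouched t v = ∀ X → ∂ t X v ≡ false

  Separates : F₂ (Fin n) → F₂ (Fin n) → Tree E → Tree E → Set
  Separates A B l r = ∀ v → B v ≡ false → Untouched l v ⊎ (A v ≡ false × Untouched r v)

  -- At a vertex outside `B` that `l` may touch, `r` contributes nothing, so the boundary of the
  -- left half equals that of the whole, which vanishes outside `A`.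
  separated : ∀ {A B l r} → Separates A B l r → ∀ {X Y} → Supported A (∂ l X ⊞ ∂ r Y) → Supported B (∂ l X)
  separated sep {X} {Y} supp v Bv with sep v Bv
  ... | inj₁ untouched = untouched X
  ... | inj₂ (Av , untouched) = trans (sym (xor-falseʳ (untouched Y))) (supp v Av)

  -- Routing demands through a tree of bounded width

  module Width (K : ℕ) where

    -- The set `A` plays the role of the vertices shared with the outside. The leaf condition says
    -- that `h e` is nonzero, so that a single edge carries no cycle.
    data Good : F₂ (Fin n) → Tree E → Set where
      nil  : ∀ {A} → Good A nil
      leaf : ∀ {A e} → (∃ λ v → h e v ≡ true) → Good A (leaf e)
      node : ∀ {A Aₗ Aᵣ l r} → count Aₗ ≤ K → count Aᵣ ≤ K →
             Separates A Aₗ l r → Separates A Aᵣ r l → Good Aₗ l → Good Aᵣ r → Good A (node l r)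

    -- At most K vectors remain after elimination, and a node appends at most K more.
    P : ℕ
    P = K + K

    open Demand P

    -- The members of lifts c realise the boundary of the combination c of Y. The combination 0 needs
    -- no lifts, since the empty set realises it.
    record Routing (t : Tree E) (Y : Vec (F₂ (Pos t)) p) (f : Vec Bool p → ℕ) : Set where
      field
        lifts   : Vec Bool p → List (F₂ (Pos t))
        enough  : ∀ c → c ≢ 0̂ → f c ≤ length (lifts c)
        correct : ∀ c → All (λ X → ∂ t X ≗ ∂ t (lin c Y)) (lifts c)
        cycles  : List (F₂ (Pos t))
        null    : All (λ Z → ∂ t Z ≗ 𝟎) cycles
        spans   : ∀ X → ∂ t X ≗ 𝟎 → Span cycles X
        load    : ∀ i → sumᵥ (λ c → congestionAt (lifts c) i) + congestionAt cycles i ≤ loadBound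

    -- A lift of `c` with respect to `Y′` realises both vectors over `c`; each list of lifts is cut
    -- in two, which leaves the load unchanged.
    eliminate-routing : ∀ {t} {Y : Vec (F₂ (Pos t)) (suc p)} {Y′ f f′} (k : Elimination p) →
                        (∀ s c → ∂ t (lin (preimage k s c) Y) ≗ ∂ t (lin c Y′)) →
                        (∀ c → c ≢ 0̂ → f (preimage k false c) + f (preimage k true c) ≤ f′ c) →
                        Routing t Y′ f′ → Routing t Y f
    eliminate-routing {p} {t} {Y} {Y′} {f} {f′} k same f≤ R = record
      { lifts = lifts′
      ; enough = λ c c≢ → via (λ c → c ≢ 0̂ → f c ≤ length (lifts′ c))
                   (λ s c c≢ → subst (λ L → _ ≤ length L) (sym (fromPreimage-preimage k half s c)) (enough′ s c c≢)) c c≢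
      ; correct = via _ λ s c → subst (All _) (sym (fromPreimage-preimage k half s c))
                    (All.map (λ eq v → trans (eq v) (sym (same s c v))) (correct′ s c))
      ; cycles = R.cycles
      ; null = R.null
      ; spans = R.spans
      ; load = λ i → ≤-trans (+-monoˡ-≤ (congestionAt R.cycles i)
                   (≤-trans (≤-reflexive (sumᵥ-preimage k (λ c → congestionAt (lifts′ c) i))) (sumᵥ-mono (load′ i))))
                 (R.load i)
      }
      where
      module R = Routing R
      half : Bool → Vec Bool p → List (F₂ (Pos t))
      half s c with c ≟₀
      half false c | yes _ = []
      -- The vector `preimage k true 0̂` is nonzero but has zero boundary: copies of the empty set
      -- serve it without any load.
      half true c | yes _ = List.replicate (f (preimage k true c)) 𝟎
      half false c | no _ = take (f (preimage k false c)) (R.lifts c)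
      half true c | no _ = drop (f (preimage k false c)) (R.lifts c)
      lifts′ = fromPreimage k half
      via : (Q : Vec Bool (suc p) → Set) → (∀ s c → Q (preimage k s c)) → ∀ c → Q c
      via Q q c = let s , d , eq = preimage-surjective k c in subst Q (sym eq) (q s d)
      enough′ : ∀ s c → preimage k s c ≢ 0̂ → f (preimage k s c) ≤ length (half s c)
      enough′ s c c≢ with c ≟₀
      enough′ false c c≢ | yes refl = ⊥-elim (c≢ (preimage-0̂ k))
      enough′ true c c≢ | yes _ = ≤-reflexive (sym (length-replicate (f (preimage k true c))))
      enough′ false c _ | no c≢ rewrite length-take (f (preimage k false c)) (R.lifts c) =
        ⊓-glb ≤-refl (≤-trans (m≤m+n _ _) (≤-trans (f≤ c c≢) (R.enough c c≢)))
      enough′ true c _ | no c≢ rewrite length-drop (f (preimage k false c)) (R.lifts c) =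
        m+n≤o⇒n≤o∸m (f (preimage k false c)) (≤-trans (f≤ c c≢) (R.enough c c≢))
      correct′ : ∀ s c → All (λ X → ∂ t X ≗ ∂ t (lin c Y′)) (half s c)
      correct′ s c with c ≟₀
      correct′ false c | yes _ = []
      correct′ true c | yes refl = All.replicate⁺ _ (λ v → ∂-cong t (λ i → sym (lin-0̂ Y′ i)) v)
      correct′ false c | no _ = All.take⁺ _ (R.correct c)
      correct′ true c | no _ = All.drop⁺ (f (preimage k false c)) (R.correct c)
      load″ : ∀ i c → congestionAt (half false c) i + congestionAt (half true c) i ≤ congestionAt (R.lifts c) i
      load″ i c with c ≟₀
      ... | yes _ = ≤-trans (≤-reflexive (congestionAt-replicate-𝟎 (f (preimage k true c)) i)) z≤n
      ... | no _ = ≤-reflexive (congestionAt-take-drop (f (preimage k false c)) (R.lifts c) i)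
      load′ : ∀ i c → congestionAt (lifts′ (preimage k false c)) i + congestionAt (lifts′ (preimage k true c)) i
                      ≤ congestionAt (R.lifts c) i
      load′ i c rewrite fromPreimage-preimage k half false c | fromPreimage-preimage k half true c = load″ i c

    -- With an injective boundary map there are no nonzero cycles, and each combination is its own
    -- lift. Here the total demand becomes a bound on the load.
    direct-routing : ∀ t (Y : Vec (F₂ (Pos t)) p) → p ≤ P → (st : State p) → Valid P st →
                     (∀ X → ∂ t X ≗ 𝟎 → X ≗ 𝟎) → Routing t Y (demand st)
    direct-routing {p} t Y p≤P st v inj = record
      { lifts = λ c → List.replicate (demand st c) (lin c Y)
      ; enough = λ c _ → ≤-reflexive (sym (length-replicate (demand st c)))
      ; correct = λ c → All.replicate⁺ (demand st c) (λ _ → refl)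
      ; cycles = []
      ; null = []
      ; spans = λ X eq → zero (inj X eq)
      ; load = λ i → ≤-trans (≤-reflexive (+-identityʳ _)) (≤-trans (sumᵥ-mono (bound i)) (total-demand P st p≤P v))
      }
      where
      bound : ∀ i c → congestionAt (List.replicate (demand st c) (lin c Y)) i ≤ demand st c
      bound i c = ≤-trans (≤-reflexive (Σₗ-replicate _ (demand st c) (lin c Y)))
                    (≤-trans (*-monoʳ-≤ (demand st c) (indicator≤1 (lin c Y i))) (≤-reflexive (*-identityʳ _)))
        where
        indicator≤1 : ∀ b → (if b then 1 else 0) ≤ 1
        indicator≤1 false = z≤n
        indicator≤1 true = ≤-refl

    -- Combining the routings of the two children

    module _ (l r : Tree E) where

      isNull? : (X : F₂ (Pos (node l r))) → Dec (∂ (node l r) X ≗ 𝟎)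
      isNull? X = ∂ (node l r) X ≗? 𝟎

      meetVal : F₂ (Pos (node l r)) → F₂ (Fin n)
      meetVal X = ∂ l (X ∘ inj₁)

      -- A basis of the intersection of the ranges of ∂ l and ∂ r.
      meet : Selection meetVal (filter isNull? (subsets (node l r)))
      meet = select meetVal _

      open Selection meet using (chosen) public

      dim : ℕ
      dim = length chosen

      U : Vec (F₂ (Pos (node l r))) dim
      U = Vec.fromList chosen

      chosen-null : All (λ X → ∂ (node l r) X ≗ 𝟎) chosen
      chosen-null = All-resp-⊆ (Selection.sublist meet) (All.all-filter isNull? (subsets (node l r)))

      U-null : ∀ s → ∂ (node l r) (lin s U) ≗ 𝟎
      U-null s v = trans (∂-lin (node l r) s U v) (go chosen chosen-null s)
        where
        go : ∀ L → All (λ X → ∂ (node l r) X ≗ 𝟎) L → (s : Vec Bool (length L)) →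
             lin s (Vec.map (∂ (node l r)) (Vec.fromList L)) v ≡ false
        go [] [] [] = refl
        go (X ∷ L) (e ∷ es) (s ∷ c) = cong₂ _xor_ (trans (cong (s ∧_) (e v)) (∧-zeroʳ s)) (go L es c)

      U-combination : ∀ s → combination meetVal chosen s ≗ ∂ l (lin s U ∘ inj₁)
      U-combination s v = sym (trans (∂-cong l (lin-∘ inj₁ s U) v)
        (trans (∂-lin l s (Vec.map (_∘ inj₁) U) v)
               (cong (λ Z → lin s Z v) (sym (Vec.map-∘ (∂ l) (_∘ inj₁) U)))))

      -- A vector in both ranges is the left boundary of a null set, hence supported on `B`; more
      -- than K such vectors would be dependent.
      dim≤ : ∀ {A B} → Separates A B l r → count B ≤ K → dim ≤ K
      dim≤ {A} {B} sep B≤ with dim ≤? K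
      ... | yes le = le
      ... | no ≰K =
        let c , c≢ , c𝟎 = relation B (combination meetVal chosen) (λ c d → lin-⊹ c d _) supp
                            (≤-<-trans B≤ (≰⇒> ≰K))
        in ⊥-elim (c≢ (Selection.independent meet c c𝟎))
        where
        supp : ∀ c → Supported B (combination meetVal chosen c)
        supp c v Bv = trans (U-combination c v)
          (separated {A} {B} {l} {r} sep {X = lin c U ∘ inj₁} {Y = lin c U ∘ inj₂} (λ v _ → U-null c v) v Bv)

      meet-spans : ∀ X → ∂ (node l r) X ≗ 𝟎 → ∃ λ s → ∂ l (X ∘ inj₁) ≗ ∂ l (lin s U ∘ inj₁)
      meet-spans X null =
        let X′ , X′∈ , X≗X′ = subsets-complete (node l r) X
            s , eq = Selection.spanning meet (∈-filter⁺ isNull? X′∈ (λ v → trans (sym (∂-cong (node l r) X≗X′ v)) (null v)))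
        in s , λ v → trans (∂-cong l (X≗X′ ∘ inj₁) v) (trans (eq v) (U-combination s v))

      module Combine {p} (Y : Vec (F₂ (Pos (node l r))) p) (st : State p) (fits : p + dim ≤ P) where

        Z : Vec (F₂ (Pos (node l r))) (p + dim)
        Z = Y Vec.++ U

        st′ : State (p + dim)
        st′ = extendₛ dim st

        Zₗ = Vec.map (_∘ inj₁) Z
        Zᵣ = Vec.map (_∘ inj₂) Z

        -- This is the freedom in splitting a demand: combinations of `U` may change what the
        -- children have to realise, but not the boundary at the node.
        ∂Z : ∀ c s → ∂ (node l r) (lin (c Vec.++ s) Z) ≗ ∂ (node l r) (lin c Y)
        ∂Z c s v = trans (∂-cong (node l r) (lin-++ c s Y U) v)
          (trans (∂-⊞ (node l r) (lin c Y) (lin s U) v) (xor-falseʳ (U-null s v)))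

        Z-supported : ∀ {A} → (∀ c → Supported A (∂ (node l r) (lin c Y))) → ∀ d → Supported A (∂ (node l r) (lin d Z))
        Z-supported supp d v Av with Vec.splitAt p d
        ... | c , s , refl = trans (∂Z c s v) (supp c v Av)

        module _ (L : Routing l Zₗ (demand st′)) (R : Routing r Zᵣ (demand st′)) where
          private
            module L = Routing L
            module R = Routing R

          -- The boundary is prescribed on each side separately; `spans` relies on this when it
          -- reduces to the two halves.
          Lift : Vec Bool (p + dim) → F₂ (Pos (node l r)) → Set
          Lift d X = ∂ l (X ∘ inj₁) ≗ ∂ l (lin d Z ∘ inj₁) × ∂ r (X ∘ inj₂) ≗ ∂ r (lin d Z ∘ inj₂)

          glued : Vec Bool (p + dim) → List (F₂ (Pos (node l r)))
          glued d = List.zipWith glue (L.lifts d) (R.lifts d)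

          glued-lift : ∀ d → All (Lift d) (glued d)
          glued-lift d = go (L.correct d) (R.correct d)
            where
            go : ∀ {Ls Rs} → All (λ X → ∂ l X ≗ ∂ l (lin d Zₗ)) Ls → All (λ X → ∂ r X ≗ ∂ r (lin d Zᵣ)) Rs →
                 All (Lift d) (List.zipWith glue Ls Rs)
            go [] [] = []
            go [] (_ ∷ _) = []
            go (_ ∷ _) [] = []
            go (e ∷ es) (e′ ∷ es′) =
              ((λ v → trans (e v) (sym (∂-cong l (lin-∘ inj₁ d Z) v))) ,
               (λ v → trans (e′ v) (sym (∂-cong r (lin-∘ inj₂ d Z) v)))) ∷ go es es′

          glued-length : ∀ d → d ≢ 0̂ → demand st′ d ≤ length (glued d)
          glued-length d d≢ = ≤-trans (⊓-glb (L.enough d d≢) (R.enough d d≢))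
            (≤-reflexive (sym (length-zipWith glue (L.lifts d) (R.lifts d))))

          glued-congestionˡ : ∀ d i → congestionAt (glued d) (inj₁ i) ≤ congestionAt (L.lifts d) i
          glued-congestionˡ d i = go (L.lifts d) (R.lifts d)
            where
            go : ∀ Ls Rs → congestionAt (List.zipWith (glue {l = l} {r = r}) Ls Rs) (inj₁ i) ≤ congestionAt Ls i
            go [] Rs = z≤n
            go (_ ∷ _) [] = z≤n
            go (X ∷ Ls) (_ ∷ Rs) = +-monoʳ-≤ (if X i then 1 else 0) (go Ls Rs)

          glued-congestionʳ : ∀ d i → congestionAt (glued d) (inj₂ i) ≤ congestionAt (R.lifts d) i
          glued-congestionʳ d i = go (L.lifts d) (R.lifts d)
            where
            go : ∀ Ls Rs → congestionAt (List.zipWith (glue {l = l} {r = r}) Ls Rs) (inj₂ i) ≤ congestionAt Rs i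
            go [] Rs = z≤n
            go (_ ∷ _) [] = z≤n
            go (_ ∷ Ls) (X ∷ Rs) = +-monoʳ-≤ (if X i then 1 else 0) (go Ls Rs)

          -- Every choice of the new coordinates serves `c`, and all of them are used to spread the
          -- demand. For `0̂` the sets are null and become the new cycles.
          liftsOver : Vec Bool p → List (F₂ (Pos (node l r)))
          liftsOver c = concatMap (λ s → glued (c Vec.++ s)) (vectors dim)

          liftsOver-congestion : ∀ c i → congestionAt (liftsOver c) i ≡ sumᵥ {dim} (λ s → congestionAt (glued (c Vec.++ s)) i)
          liftsOver-congestion c i = trans (Σₗ-concatMap _ _ (vectors dim)) (Σₗ-vectors {dim} _)

          liftsOver-length : ∀ c → c ≢ 0̂ → demand st c ≤ length (liftsOver c)
          liftsOver-length c c≢ = begin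
            demand st c                                   ≤⟨ extend-demand dim fits st c ⟩
            sumᵥ {dim} (λ s → demand st′ (c Vec.++ s))    ≤⟨ sumᵥ-mono {dim} (λ s → glued-length (c Vec.++ s) (c≢ ∘ prefix c s)) ⟩
            sumᵥ {dim} (λ s → length (glued (c Vec.++ s))) ≡⟨ Σₗ-vectors {dim} _ ⟨
            Σₗ (λ s → length (glued (c Vec.++ s))) (vectors dim) ≡⟨ length-concatMap _ (vectors dim) ⟨
            length (liftsOver c)                          ∎
            where
            open ≤-Reasoning
            prefix : ∀ {p q} (c : Vec Bool p) (s : Vec Bool q) → c Vec.++ s ≡ 0̂ → c ≡ 0̂
            prefix [] s eq = refl
            prefix (t ∷ c) s eq = cong₂ _∷_ (cong Vec.head eq) (prefix c s (cong Vec.tail eq))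

          liftsOver-correct : ∀ c → All (λ X → ∂ (node l r) X ≗ ∂ (node l r) (lin c Y)) (liftsOver c)
          liftsOver-correct c = All.concat⁺ (All.map⁺ (All.universal
            (λ s → All.map (λ (eₗ , eᵣ) v → trans (cong₂ _xor_ (eₗ v) (eᵣ v)) (∂Z c s v)) (glued-lift (c Vec.++ s))) (vectors dim)))

          lifts : Vec Bool p → List (F₂ (Pos (node l r)))
          lifts c with c ≟₀
          ... | yes _ = []
          ... | no _ = liftsOver c

          fromLeft : F₂ (Pos l) → F₂ (Pos (node l r))
          fromLeft X = glue X 𝟎

          fromRight : F₂ (Pos r) → F₂ (Pos (node l r))
          fromRight X = glue 𝟎 X

          newCycles : List (F₂ (Pos (node l r)))
          newCycles = liftsOver 0̂

          allCycles : List (F₂ (Pos (node l r)))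
          allCycles = map fromLeft L.cycles ++ map fromRight R.cycles ++ newCycles

          spans-halves : ∀ X → ∂ l (X ∘ inj₁) ≗ 𝟎 → ∂ r (X ∘ inj₂) ≗ 𝟎 → Span allCycles X
          spans-halves X eₗ eᵣ = Span-resp
            (λ { (inj₁ i) → sym (xor-identityʳ _) ; (inj₂ i) → refl })
            (Span-⊞
              (Span-map fromLeft (λ { eq (inj₁ i) → eq i ; eq (inj₂ i) → refl }) (λ { (inj₁ i) → refl ; (inj₂ i) → refl })
                (λ { x y (inj₁ i) → refl ; x y (inj₂ i) → refl }) (λ z∈ → ∈-++⁺ˡ (∈-map⁺ fromLeft z∈)) (L.spans _ eₗ))
              (Span-map fromRight (λ { eq (inj₁ i) → refl ; eq (inj₂ i) → eq i }) (λ { (inj₁ i) → refl ; (inj₂ i) → refl })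
                (λ { x y (inj₁ i) → refl ; x y (inj₂ i) → refl })
                (λ z∈ → ∈-++⁺ʳ (map fromLeft L.cycles) (∈-++⁺ˡ (∈-map⁺ fromRight z∈))) (R.spans _ eᵣ)))

          nonempty : ∀ {A : Set} {L : List A} → 1 ≤ length L → ∃ λ x → x ∈ L
          nonempty {L = x ∷ L} _ = x , here refl

          spans : ∀ X → ∂ (node l r) X ≗ 𝟎 → Span allCycles X
          spans X null with meet-spans X null
          ... | s , eq with s ≟₀
          ...   | yes refl = spans-halves X left (λ v → trans (sym (xor≡false (null v))) (left v))
            where
            left : ∂ l (X ∘ inj₁) ≗ 𝟎
            left v = trans (eq v) (trans (∂-cong l (lin-0̂ U ∘ inj₁) v) (∂-𝟎 l v))
          ...   | no s≢ = add W∈allCycles (spans-halves (W ⊞ X) left right)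
                            (λ i → sym (xor-cancelˡ (W i) (X i)))
            where
            suffix : ∀ p {q} (s : Vec Bool q) → 0̂ {p} Vec.++ s ≡ 0̂ → s ≡ 0̂
            suffix zero s eq = eq
            suffix (suc p) s eq = suffix p s (cong Vec.tail eq)
            d = 0̂ {p} Vec.++ s
            -- The fresh blocks demand every nonzero `s` with zero old coordinates. Hence some new
            -- cycle has the same left boundary as `X`, and adding it makes both halves null.
            chosenW = nonempty (≤-trans (extend-fresh st s s≢) (glued-length d (s≢ ∘ suffix p s)))
            W = proj₁ chosenW
            W∈ = proj₂ chosenW
            W∈allCycles : W ∈ allCycles
            W∈allCycles = ∈-++⁺ʳ (map fromLeft L.cycles) (∈-++⁺ʳ (map fromRight R.cycles)
              (∈-concatMap⁺ (λ s → glued (0̂ Vec.++ s)) (Any.map (λ { refl → W∈ }) (∈-vectors s))))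
            lin-d : lin d Z ≗ lin s U
            lin-d i = trans (lin-++ (0̂ {p}) s Y U i) (cong (_xor lin s U i) (lin-0̂ Y i))
            Wₗ : ∂ l (W ∘ inj₁) ≗ ∂ l (lin s U ∘ inj₁)
            Wₗ v = trans (proj₁ (All.lookup (glued-lift d) W∈) v) (∂-cong l (lin-d ∘ inj₁) v)
            Wᵣ : ∂ r (W ∘ inj₂) ≗ ∂ r (lin s U ∘ inj₂)
            Wᵣ v = trans (proj₂ (All.lookup (glued-lift d) W∈) v) (∂-cong r (lin-d ∘ inj₂) v)
            left : ∂ l ((W ⊞ X) ∘ inj₁) ≗ 𝟎
            left v = trans (∂-⊞ l (W ∘ inj₁) (X ∘ inj₁) v) (trans (cong₂ _xor_ (Wₗ v) (eq v)) (xor-same (∂ l (lin s U ∘ inj₁) v)))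
            right : ∂ r ((W ⊞ X) ∘ inj₂) ≗ 𝟎
            right v = trans (∂-⊞ r (W ∘ inj₂) (X ∘ inj₂) v)
              (trans (cong₂ _xor_
                 (trans (Wᵣ v) (sym (xor≡false {∂ l (lin s U ∘ inj₁) v} (U-null s v))))
                 (trans (sym (xor≡false (null v))) (eq v)))
                 (xor-same (∂ l (lin s U ∘ inj₁) v)))

          cycles-null : All (λ X → ∂ (node l r) X ≗ 𝟎) allCycles
          cycles-null = All.++⁺
            (All.map⁺ (All.map (λ e v → cong₂ _xor_ (e v) (∂-𝟎 r v)) L.null))
            (All.++⁺ (All.map⁺ (All.map (λ e v → cong₂ _xor_ (∂-𝟎 l v) (e v)) R.null))
              (All.map (λ e v → trans (e v) (trans (∂-cong (node l r) (lin-0̂ Y) v) (∂-𝟎 (node l r) v))) (liftsOver-correct 0̂)))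

          cycles-congestion : ∀ i → congestionAt allCycles i ≡
            congestionAt (map fromLeft L.cycles) i + (congestionAt (map fromRight R.cycles) i + congestionAt newCycles i)
          cycles-congestion i = trans (Σₗ-++ _ (map fromLeft L.cycles) _)
            (cong (congestionAt (map fromLeft L.cycles) i +_) (Σₗ-++ _ (map fromRight R.cycles) _))

          lifts-congestion : ∀ i → sumᵥ (λ c → congestionAt (lifts c) i) + congestionAt newCycles i ≤
                                   sumᵥ (λ d → congestionAt (glued d) i)
          lifts-congestion i = begin
            sumᵥ (λ c → congestionAt (lifts c) i) + congestionAt newCycles i
              ≤⟨ sumᵥ-without-0̂ (λ c → congestionAt (liftsOver c) i) _ smaller at-0̂ ⟩
            sumᵥ (λ c → congestionAt (liftsOver c) i)
              ≡⟨ sumᵥ-cong (λ c → liftsOver-congestion c i) ⟩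
            sumᵥ {p} (λ c → sumᵥ {dim} (λ s → congestionAt (glued (c Vec.++ s)) i))
              ≡⟨ sumᵥ-++ p {dim} _ ⟨
            sumᵥ (λ d → congestionAt (glued d) i) ∎
            where
            open ≤-Reasoning
            smaller : ∀ c → congestionAt (lifts c) i ≤ congestionAt (liftsOver c) i
            smaller c with c ≟₀
            ... | yes _ = z≤n
            ... | no _ = ≤-refl
            at-0̂ : congestionAt (lifts 0̂) i ≡ 0
            at-0̂ with 0̂ {p} ≟₀
            ... | yes _ = refl
            ... | no 0≢ = ⊥-elim (0≢ refl)

          -- An edge is loaded only by sets coming from its own side, each counted once. The load
          -- passes from child to node without growing, so one bound serves trees of any depth.
          load : ∀ i → sumᵥ (λ c → congestionAt (lifts c) i) + congestionAt allCycles i ≤ loadBound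
          load (inj₁ i) = begin
            X + congestionAt allCycles (inj₁ i)   ≡⟨ cong (X +_) (cycles-congestion (inj₁ i)) ⟩
            X + (congestionAt (map fromLeft L.cycles) (inj₁ i) + (congestionAt (map fromRight R.cycles) (inj₁ i) + N))
              ≡⟨ cong₂ (λ a b → X + (a + (b + N))) (Σₗ-map _ fromLeft L.cycles)
                   (trans (Σₗ-map _ fromRight R.cycles) (trans (Σₗ-const (λ _ → refl) R.cycles) (*-zeroʳ (length R.cycles)))) ⟩
            X + (congestionAt L.cycles i + N)  ≡⟨ trans (cong (X +_) (+-comm _ N)) (sym (+-assoc X N _)) ⟩
            X + N + congestionAt L.cycles i    ≤⟨ +-monoˡ-≤ _ (≤-trans (lifts-congestion (inj₁ i)) (sumᵥ-mono (λ d → glued-congestionˡ d i))) ⟩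
            sumᵥ (λ d → congestionAt (L.lifts d) i) + congestionAt L.cycles i ≤⟨ L.load i ⟩
            loadBound ∎
            where
            open ≤-Reasoning
            X = sumᵥ (λ c → congestionAt (lifts c) (inj₁ i))
            N = congestionAt newCycles (inj₁ i)
          load (inj₂ i) = begin
            X + congestionAt allCycles (inj₂ i)   ≡⟨ cong (X +_) (cycles-congestion (inj₂ i)) ⟩
            X + (congestionAt (map fromLeft L.cycles) (inj₂ i) + (congestionAt (map fromRight R.cycles) (inj₂ i) + N))
              ≡⟨ cong₂ (λ a b → X + (a + (b + N)))
                   (trans (Σₗ-map _ fromLeft L.cycles) (trans (Σₗ-const (λ _ → refl) L.cycles) (*-zeroʳ (length L.cycles))))
                   (Σₗ-map _ fromRight R.cycles) ⟩
            X + (congestionAt R.cycles i + N)  ≡⟨ trans (cong (X +_) (+-comm _ N)) (sym (+-assoc X N _)) ⟩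
            X + N + congestionAt R.cycles i    ≤⟨ +-monoˡ-≤ _ (≤-trans (lifts-congestion (inj₂ i)) (sumᵥ-mono (λ d → glued-congestionʳ d i))) ⟩
            sumᵥ (λ d → congestionAt (R.lifts d) i) + congestionAt R.cycles i ≤⟨ R.load i ⟩
            loadBound ∎
            where
            open ≤-Reasoning
            X = sumᵥ (λ c → congestionAt (lifts c) (inj₂ i))
            N = congestionAt newCycles (inj₂ i)

          combined : Routing (node l r) Y (demand st)
          combined = record
            { lifts = lifts
            ; enough = λ c c≢ → subst (λ L → demand st c ≤ length L) (sym (lifts-≢ c c≢)) (liftsOver-length c c≢)
            ; correct = correct
            ; cycles = allCycles
            ; null = cycles-null
            ; spans = spans
            ; load = load
            }
            where
            lifts-≢ : ∀ c → c ≢ 0̂ → lifts c ≡ liftsOver c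
            lifts-≢ c c≢ with c ≟₀
            ... | yes eq = ⊥-elim (c≢ eq)
            ... | no _ = refl
            correct : ∀ c → All (λ X → ∂ (node l r) X ≗ ∂ (node l r) (lin c Y)) (lifts c)
            correct c with c ≟₀
            ... | yes _ = []
            ... | no _ = liftsOver-correct c

    -- Recursion on the tree

    -- While there are more than K vectors, their boundaries, supported on `A`, satisfy a relation
    -- and one vector is eliminated. Then `route-small` can descend, since p plus the dimension of
    -- the meet is at most P.
    route : ∀ t {A} → count A ≤ K → Good A t → ∀ p (Y : Vec (F₂ (Pos t)) p) →
            (∀ c → Supported A (∂ t (lin c Y))) → p ≤ P → (st : State p) → Valid P st → Routing t Y (demand st)

    route-small : ∀ t {A} → Good A t → ∀ p (Y : Vec (F₂ (Pos t)) p) →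
                  (∀ c → Supported A (∂ t (lin c Y))) → p ≤ K → (st : State p) → Valid P st → Routing t Y (demand st)

    route t A≤ good p Y supp p≤P st v with p ≤? K
    ... | yes p≤K = route-small t good p Y supp p≤K st v
    route t A≤ good zero Y supp p≤P st v | no p≰K = ⊥-elim (p≰K z≤n)
    route t {A} A≤ good (suc p) Y supp p≤P st v | no p≰K =
      eliminate-routing k same (eliminate-demand p≤P k st)
        (route t A≤ good p Y′ (λ c i Ai → trans (sym (same false c i)) (supp (preimage k false c) i Ai))
               (<⇒≤ p≤P) (eliminateₛ k st) (eliminate-valid P p≤P k st v))
      where
      rel = relation A (λ c → ∂ t (lin c Y)) (∂-lin-linear t Y) supp (≤-<-trans A≤ (≰⇒> p≰K))
      c₀ = proj₁ rel
      c₀≢ = proj₁ (proj₂ rel)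
      k = leading c₀ c₀≢
      Y′ = removeAt k Y
      same : ∀ s c → ∂ t (lin (preimage k s c) Y) ≗ ∂ t (lin c Y′)
      same s c i = begin
        ∂ t (lin (preimage k s c) Y) i            ≡⟨ ∂-lin t (preimage k s c) Y i ⟩
        lin (preimage k s c) (Vec.map (∂ t) Y) i  ≡⟨ leading-preimage c₀ c₀≢ (Vec.map (∂ t) Y)
                                                           (λ i → trans (sym (∂-lin t c₀ Y i)) (proj₂ (proj₂ rel) i)) s c i ⟩
        lin c (removeAt k (Vec.map (∂ t) Y)) i    ≡⟨ cong (λ Z → lin c Z i) (map-removeAt (∂ t) k Y) ⟨
        lin c (Vec.map (∂ t) Y′) i                ≡⟨ ∂-lin t c Y′ i ⟨
        ∂ t (lin c Y′) i                          ∎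
        where open ≡-Reasoning

    route-small nil good p Y supp p≤K st v =
      direct-routing nil Y (≤-trans p≤K (m≤m+n K K)) st v (λ X _ ())
    route-small (leaf e) (leaf (w , hw)) p Y supp p≤K st v =
      direct-routing (leaf e) Y (≤-trans p≤K (m≤m+n K K)) st v
        (λ X eq _ → trans (sym (∧-identityʳ (X tt))) (trans (cong (X tt ∧_) (sym hw)) (eq w)))
    route-small (node l r) {A} (node {Aₗ = Aₗ} {Aᵣ} Aₗ≤ Aᵣ≤ sepₗ sepᵣ goodₗ goodᵣ) p Y supp p≤K st v =
      combined
        (route l Aₗ≤ goodₗ (p + dim l r) Zₗ suppₗ fits st′ valid)
        (route r Aᵣ≤ goodᵣ (p + dim l r) Zᵣ suppᵣ fits st′ valid)
      where
      fits : p + dim l r ≤ P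
      fits = +-mono-≤ p≤K (dim≤ l r sepₗ Aₗ≤)
      open Combine l r Y st fits
      valid : Valid P st′
      valid = extend-valid P (dim l r) st fits v
      suppₗ : ∀ d → Supported Aₗ (∂ l (lin d Zₗ))
      suppₗ d i Ai = trans (sym (∂-cong l (lin-∘ inj₁ d Z) i))
        (separated {A} {Aₗ} {l} {r} sepₗ {lin d Z ∘ inj₁} {lin d Z ∘ inj₂} (Z-supported supp d) i Ai)
      suppᵣ : ∀ d → Supported Aᵣ (∂ r (lin d Zᵣ))
      suppᵣ d i Ai = trans (sym (∂-cong r (lin-∘ inj₂ d Z) i))
        (separated {A} {Aᵣ} {r} {l} sepᵣ {lin d Z ∘ inj₂} {lin d Z ∘ inj₁}
          (λ j Aj → trans (xor-comm (∂ r (lin d Z ∘ inj₂) j) _) (Z-supported supp d j Aj)) i Ai)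

-- Acyclic graphs

module Leaves (T : Graph) where

  Adj-sym : ∀ {u v} → Adj T u v → Adj T v u
  Adj-sym (e , eq) = e , swap eq

  Adj-irrefl : ∀ {u v} → Adj T u v → u ≢ v
  Adj-irrefl (e , inj₁ eq) refl = loopless T e (trans (cong proj₁ eq) (sym (cong proj₂ eq)))
  Adj-irrefl (e , inj₂ eq) refl = loopless T e (trans (cong proj₁ eq) (sym (cong proj₂ eq)))

  Adj? : ∀ u v → Dec (Adj T u v)
  Adj? u v = Fin.any? λ e → ≡-dec _≟_ _≟_ (ends T e) (u , v) ⊎-dec ≡-dec _≟_ _≟_ (ends T e) (v , u)

  -- Only x 0, …, x l matter.
  record SimplePath (l : ℕ) (x : ℕ → Vertex T) : Set where
    field
      adj : ∀ i → i < l → Adj T (x i) (x (suc i))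
      inj : ∀ i j → i ≤ l → j ≤ l → x i ≡ x j → i ≡ j

  toℕ-next : ∀ {l} (i : Fin (suc l)) → (toℕ i < l × toℕ (next i) ≡ suc (toℕ i)) ⊎ (toℕ i ≡ l × toℕ (next i) ≡ 0)
  toℕ-next {l} i with toℕ i <? l
  ... | yes p = inj₁ (p , cong suc (Fin.toℕ-fromℕ< p))
  ... | no ≮l = inj₂ (≤-antisym (s≤s⁻¹ (Fin.toℕ<n i)) (≮⇒≥ ≮l) , refl)

  close : ∀ {l x} → SimplePath (suc (suc l)) x → Adj T (x (suc (suc l))) (x 0) → GraphCycle T
  close {l} {x} path back = record
    { len′ = l
    ; vert = x ∘ toℕ
    ; inj  = λ i j eq → Fin.toℕ-injective (inj _ _ (s≤s⁻¹ (Fin.toℕ<n i)) (s≤s⁻¹ (Fin.toℕ<n j)) eq)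
    ; adj  = closing
    }
    where
    open SimplePath path
    closing : ∀ i → Adj T (x (toℕ i)) (x (toℕ (next i)))
    closing i with toℕ-next i
    ... | inj₁ (lt , eq) = subst (λ j → Adj T (x (toℕ i)) (x j)) (sym eq) (adj (toℕ i) lt)
    ... | inj₂ (last , eq) = subst₂ (λ i j → Adj T (x i) (x j)) (sym last) (sym eq) back

  truncate : ∀ {l m x} → m ≤ l → SimplePath l x → SimplePath m x
  truncate m≤l path = record
    { adj = λ i i<m → adj i (<-≤-trans i<m m≤l)
    ; inj = λ i j i≤m j≤m → inj i j (≤-trans i≤m m≤l) (≤-trans j≤m m≤l)
    }
    where open SimplePath path

  _◂_ : Vertex T → (ℕ → Vertex T) → ℕ → Vertex T
  (z ◂ x) zero = z
  (z ◂ x) (suc i) = x i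

  prepend : ∀ {l x z} → SimplePath l x → Adj T z (x 0) → (∀ i → i ≤ l → x i ≢ z) → SimplePath (suc l) (z ◂ x)
  prepend {l} {x} {z} path a new = record
    { adj = λ { zero _ → a ; (suc i) (s≤s lt) → adj i lt }
    ; inj = λ { zero zero _ _ _ → refl
              ; zero (suc j) _ (s≤s j≤) eq → ⊥-elim (new j j≤ (sym eq))
              ; (suc i) zero (s≤s i≤) _ eq → ⊥-elim (new i i≤ eq)
              ; (suc i) (suc j) (s≤s i≤) (s≤s j≤) eq → cong suc (inj i j i≤ j≤ eq) }
    }
    where open SimplePath path

  bounded : ∀ {l x} → SimplePath l x → l < n T
  bounded {l} {x} path with l <? n T
  ... | yes lt = lt
  ... | no ≮n with Fin.pigeonhole (s≤s (≮⇒≥ ≮n)) (λ (i : Fin (suc l)) → x (toℕ i))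
  ...   | i , j , i<j , eq = ⊥-elim (<⇒≢ i<j (SimplePath.inj path _ _ (s≤s⁻¹ (Fin.toℕ<n i)) (s≤s⁻¹ (Fin.toℕ<n j)) eq))

  -- The child has at most one neighbour in `S`. If it has none, any other member of `S` can be the
  -- parent.
  record Leaf (S : List (Vertex T)) : Set where
    field
      child parent   : Vertex T
      child∈         : child ∈ S
      parent∈        : parent ∈ S
      parent≢child   : parent ≢ child
      only-neighbour : ∀ {z} → z ∈ S → Adj T child z → z ≡ parent

  module _ (acyclic : Acyclic T) (S : List (Vertex T)) where

    -- The path is prolonged at `x 0` until `x 0` has no neighbour in `S` besides `x 1`. Another
    -- neighbour on the path would close a cycle, and a simple path has fewer than `n T` edges,
    -- which bounds the fuel.
    grow : ∀ fuel l x → n T ≤ suc l + fuel → SimplePath (suc l) x → (∀ i → i ≤ suc l → x i ∈ S) → Leaf S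
    grow zero l x le path _ = ⊥-elim (<-irrefl refl (<-≤-trans (bounded path) (≤-trans le (≤-reflexive (+-identityʳ _)))))
    grow (suc fuel) l x le path x∈ with any? (λ z → Adj? (x 0) z ×-dec ¬? (z ≟ x 1)) S
    ... | no none = record
      { child = x 0 ; parent = x 1 ; child∈ = x∈ 0 z≤n ; parent∈ = x∈ 1 (s≤s z≤n)
      ; parent≢child = λ eq → 1+n≢0 (SimplePath.inj path 1 0 (s≤s z≤n) z≤n eq)
      ; only-neighbour = λ {z} z∈ a → unique z z∈ a
      }
      where
      unique : ∀ z → z ∈ S → Adj T (x 0) z → z ≡ x 1
      unique z z∈ a with z ≟ x 1
      ... | yes eq = eq
      ... | no ≢x₁ = ⊥-elim (none (lose z∈ (a , ≢x₁)))
    ... | yes some with find some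
    ...   | z , z∈ , a , z≢x₁ with anyUpTo? (λ i → x i ≟ z) (suc (suc l))
    ...     | no new = grow fuel (suc l) (z ◂ x) (≤-trans le (≤-reflexive (+-suc (suc l) fuel)))
                         (prepend path (Adj-sym a) (λ i i≤ eq → new (i , s≤s i≤ , eq)))
                         λ { zero _ → z∈ ; (suc i) (s≤s i≤) → x∈ i i≤ }
    ...     | yes (zero , _ , eq) = ⊥-elim (Adj-irrefl a eq)
    ...     | yes (suc zero , _ , eq) = ⊥-elim (z≢x₁ (sym eq))
    ...     | yes (suc (suc j) , lt , eq) =
                ⊥-elim (acyclic (close (truncate (s≤s⁻¹ lt) path) (subst (λ w → Adj T w (x 0)) (sym eq) (Adj-sym a))))

    findLeaf : ∀ {x y} → x ∈ S → y ∈ S → x ≢ y → Leaf S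
    findLeaf {x} {y} x∈ y∈ x≢y with any? (Adj? x) S
    ... | no none = record
      { child = x ; parent = y ; child∈ = x∈ ; parent∈ = y∈ ; parent≢child = x≢y ∘ sym
      ; only-neighbour = λ z∈ a → ⊥-elim (none (lose z∈ a)) }
    ... | yes some with find some
    ...   | z , z∈ , a = grow (n T) 0 (z ◂ λ _ → x) (n≤1+n _)
              (prepend {x = λ _ → x} (record { adj = λ i () ; inj = λ { zero zero _ _ _ → refl } }) (Adj-sym a) (λ _ _ → Adj-irrefl a))
              λ { zero _ → z∈ ; (suc i) _ → x∈ }

-- From a tree decomposition to an edge-labelled tree

module Incidence (G : Graph) where

  h : Edge G → F₂ (Vertex G)
  h e v = incident G v e

  open Boundary h public

  ⌊≟⌋-refl : ∀ {k} (i : Fin k) → ⌊ i ≟ i ⌋ ≡ true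
  ⌊≟⌋-refl i with i ≟ i
  ... | yes _ = refl
  ... | no i≢i = ⊥-elim (i≢i refl)

  endpoint : ∀ {e v} → h e v ≡ true → proj₁ (ends G e) ≡ v ⊎ proj₂ (ends G e) ≡ v
  endpoint {e} {v} eq with proj₁ (ends G e) ≟ v | proj₂ (ends G e) ≟ v
  ... | yes p | _ = inj₁ p
  ... | no _ | yes q = inj₂ q

  Meets : Tree (Edge G) → Vertex G → Set
  Meets t v = ∃ λ i → h (label t i) v ≡ true

  meets? : ∀ t v → Dec (Meets t v)
  meets? nil v = no λ ()
  meets? (leaf e) v = map′ (tt ,_) proj₂ (h e v Bool.≟ true)
  meets? (node l r) v =
    map′ (λ { (inj₁ (i , eq)) → inj₁ i , eq ; (inj₂ (i , eq)) → inj₂ i , eq })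
         (λ { (inj₁ i , eq) → inj₁ (i , eq) ; (inj₂ i , eq) → inj₂ (i , eq) })
         (meets? l v ⊎-dec meets? r v)

  untouched : ∀ t v → ¬ Meets t v → Untouched t v
  untouched nil v ¬m X = refl
  untouched (leaf e) v ¬m X with h e v
  ... | true = ⊥-elim (¬m (tt , refl))
  ... | false = ∧-zeroʳ (X tt)
  untouched (node l r) v ¬m X =
    cong₂ _xor_ (untouched l v (λ (i , eq) → ¬m (inj₁ i , eq)) (X ∘ inj₁))
                (untouched r v (λ (i , eq) → ¬m (inj₂ i , eq)) (X ∘ inj₂))

  separates : ∀ {A B l r} → (∀ {v} → Meets l v → B v ≡ false → A v ≡ false × ¬ Meets r v) → Separates A B l r
  separates {l = l} {r} sep v Bv with meets? l v
  ... | no ¬m = inj₁ (untouched l v ¬m)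
  ... | yes m = let Av , ¬m = sep m Bv in inj₂ (Av , untouched r v ¬m)

  Injective : Tree (Edge G) → Set
  Injective t = ∀ i j → label t i ≡ label t j → i ≡ j

  comb : List (Edge G) → Tree (Edge G)
  comb [] = nil
  comb (e ∷ L) = node (leaf e) (comb L)

  comb-label : ∀ L i → label (comb L) i ∈ L
  comb-label (e ∷ L) (inj₁ _) = here refl
  comb-label (e ∷ L) (inj₂ i) = there (comb-label L i)

  comb-position : ∀ {L e} → e ∈ L → ∃ λ i → label (comb L) i ≡ e
  comb-position (here refl) = inj₁ tt , refl
  comb-position (there e∈) = let i , eq = comb-position e∈ in inj₂ i , eq

  comb-injective : ∀ {L} → Unique L → Injective (comb L)
  comb-injective (_ ∷ _) (inj₁ _) (inj₁ _) eq = refl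
  comb-injective {e ∷ L} (e≢ ∷ _) (inj₁ _) (inj₂ j) eq = ⊥-elim (All.lookup e≢ (comb-label L j) eq)
  comb-injective {e ∷ L} (e≢ ∷ _) (inj₂ i) (inj₁ _) eq = ⊥-elim (All.lookup e≢ (comb-label L i) (sym eq))
  comb-injective (_ ∷ u) (inj₂ i) (inj₂ j) eq = cong inj₂ (comb-injective u i j eq)

  record Layout (K : ℕ) : Set where
    open Width K
    field
      layout    : Tree (Edge G)
      boundary  : F₂ (Vertex G)
      narrow    : count boundary ≤ K
      good      : Good boundary layout
      position  : ∀ e → ∃ λ i → label layout i ≡ e
      injective : Injective layout

  -- Contracting the decomposition tree leaf by leaf

  module Decomposed (D : TreeDecomposition G) (K : ℕ) (bag≤ : ∀ x → count (bag D x) ≤ K) where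

    open Width K

    private
      T = tree D
    open Leaves T

    home : Edge G → Vertex T
    home e = proj₁ (ecover D e)

    home-bag : ∀ {e v} → h e v ≡ true → bag D (home e) v ≡ true
    home-bag {e} {v} eq with endpoint {e} {v} eq
    ... | inj₁ refl = proj₁ (proj₂ (ecover D e))
    ... | inj₂ refl = proj₂ (proj₂ (ecover D e))

    -- A partition of the nodes of T into connected parts, each represented by the only one of its
    -- nodes that may have neighbours in other parts.
    record Clustering (S : List (Vertex T)) : Set where
      field
        owner     : Vertex T → Vertex T
        owner∈    : ∀ x → owner x ∈ S
        owner-S   : ∀ {x} → x ∈ S → owner x ≡ x
        portals   : ∀ {a b} → Adj T a b → owner a ≢ owner b → owner a ≡ a × owner b ≡ b
        part      : Vertex T → Tree (Edge G)
        good      : ∀ x → Good (bag D x) (part x)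
        located   : ∀ e → ∃ λ i → label (part (owner (home e))) i ≡ e
        owned     : ∀ x i → owner (home (label (part x) i)) ≡ x
        injective : ∀ x → Injective (part x)

    initial : Clustering (allFin (n T))
    initial = record
      { owner = id
      ; owner∈ = ∈-allFin
      ; owner-S = λ _ → refl
      ; portals = λ _ _ → refl , refl
      ; part = λ x → comb (edgesAt x)
      ; good = λ x → comb-good x (edgesAt x) λ e∈ → proj₂ (∈-filter⁻ (at? x) {xs = allFin (m G)} e∈)
      ; located = λ e → comb-position (∈-filter⁺ (at? (home e)) (∈-allFin e) refl)
      ; owned = λ x i → proj₂ (∈-filter⁻ (at? x) {xs = allFin (m G)} (comb-label (edgesAt x) i))
      ; injective = λ x → comb-injective (Unique.filter⁺ (at? x) (Unique.allFin⁺ (m G)))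
      }
      where
      at? : ∀ x e → Dec (home e ≡ x)
      at? x e = home e ≟ x
      edgesAt : Vertex T → List (Edge G)
      edgesAt x = filter (at? x) (allFin (m G))
      comb-good : ∀ x L → (∀ {e} → e ∈ L → home e ≡ x) → Good (bag D x) (comb L)
      comb-good x [] at = nil
      comb-good x (e ∷ L) at = node (bag≤ x) (bag≤ x) (inside (leaf e) (comb L) λ _ → at (here refl))
          (inside (comb L) (leaf e) λ i → at (there (comb-label L i)))
          (leaf (proj₁ (ends G e) , cong (_∨ ⌊ proj₂ (ends G e) ≟ proj₁ (ends G e) ⌋) (⌊≟⌋-refl (proj₁ (ends G e)))))
          (comb-good x L (at ∘ there))
        where
        inside : ∀ l r → (∀ i → home (label l i) ≡ x) → Separates (bag D x) (bag D x) l r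
        -- All edges of the comb have home `x`, so every vertex that they meet lies in the bag of
        -- `x`.
        inside l r at = separates λ {v} (i , eq) xv → case-false (trans (sym (home-bag eq)) (trans (cong (λ y → bag D y v) (at i)) xv))
          where
          case-false : ∀ {A : Set} → true ≡ false → A
          case-false ()

    module Merge {S} (C : Clustering S) (leaf : Leaf S) where
      open Clustering C
      open Leaf leaf renaming (child to y; parent to u)

      owner′ : Vertex T → Vertex T
      owner′ x with owner x ≟ y
      ... | yes _ = u
      ... | no _ = owner x

      owner′-y : ∀ {x} → owner x ≡ y → owner′ x ≡ u
      owner′-y {x} eq with owner x ≟ y
      ... | yes _ = refl
      ... | no ≢y = ⊥-elim (≢y eq)

      owner′-other : ∀ {x} → owner x ≢ y → owner′ x ≡ owner x
      owner′-other {x} ≢y with owner x ≟ y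
      ... | yes eq = ⊥-elim (≢y eq)
      ... | no _ = refl

      owner-p : owner u ≡ u
      owner-p = owner-S parent∈

      keep? : ∀ x → Dec (x ≢ y)
      keep? x = ¬? (x ≟ y)

      S′ : List (Vertex T)
      S′ = filter keep? S

      smaller : length S′ < length S
      smaller = filter-notAll keep? S (lose child∈ λ y≢y → y≢y refl)

      part′ : Vertex T → Tree (Edge G)
      part′ x with x ≟ u | x ≟ y
      ... | yes _ | _ = node (part u) (part y)
      ... | no _ | yes _ = nil
      ... | no _ | no _ = part x

      neighbour : ∀ {c d} → Adj T c d → owner c ≡ y → owner d ≢ y → c ≡ y × d ≡ u
      neighbour {c} {d} a oc od with portals a (λ eq → od (trans (sym eq) oc))
      ... | c-fixed , d-fixed = c≡y , only-neighbour (subst (_∈ S) d-fixed (owner∈ d)) (subst (λ z → Adj T z d) c≡y a)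
        where c≡y = trans (sym c-fixed) oc

      -- The part of `y` can be left only along an edge from `y` to `u`, as `y` is its portal and
      -- has no other neighbour in `S`. With the subtree condition, a vertex in bags on both sides
      -- lies in the bags of `y` and `u`.
      crossing : ∀ {Q a b} → Walk T Q a b → owner a ≡ y → owner b ≢ y → Q y × Q u
      crossing (here _) oa ob = ⊥-elim (ob oa)
      crossing (step {y = c} qa a w) oa ob with owner c ≟ y
      ... | yes oc = crossing w oc ob
      ... | no oc with neighbour a oa oc | w
      ...   | refl , refl | here q = qa , q
      ...   | refl , refl | step q _ _ = qa , q

      crossing-bags : ∀ {v a b} → bag D a v ≡ true → bag D b v ≡ true → owner a ≡ y → owner b ≢ y →
                      bag D y v ≡ true × bag D u v ≡ true
      crossing-bags {v} {a} {b} av bv = crossing (subtree D v a b av bv)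

      true≢false : ∀ {b} → b ≡ true → b ≢ false
      true≢false refl ()

      both : ∀ {v} → Meets (part y) v → Meets (part u) v → bag D y v ≡ true × bag D u v ≡ true
      both (i , eq) (j , eq′) = crossing-bags (home-bag eq) (home-bag eq′) (owned y i)
        (λ o → parent≢child (trans (sym (owned u j)) o))

      false-or : ∀ b → (b ≡ true → ⊥) → b ≡ false
      false-or false _ = refl
      false-or true ¬true = ⊥-elim (¬true refl)

      good-node : Good (bag D u) (node (part u) (part y))
      good-node = node (bag≤ u) (bag≤ y)
        (separates λ mp pv → pv , λ my → true≢false (proj₂ (both my mp)) pv)
        (separates λ { {v} my@(i , eq) yv →
            false-or _ (λ pv → true≢false (proj₁ (crossing-bags (home-bag eq) pv (owned y i) (λ o → parent≢child (trans (sym owner-p) o)))) yv)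
          , λ mp → true≢false (proj₁ (both my mp)) yv })
        (good u) (good y)

      good′ : ∀ x → Good (bag D x) (part′ x)
      good′ x with x ≟ u | x ≟ y
      ... | yes refl | _ = good-node
      ... | no _ | yes _ = nil
      ... | no _ | no _ = good x

      owned′ : ∀ x i → owner′ (home (label (part′ x) i)) ≡ x
      owned′ x i with x ≟ u | x ≟ y
      owned′ x (inj₁ i) | yes refl | _ = trans (owner′-other λ eq → parent≢child (trans (sym (owned u i)) eq)) (owned u i)
      owned′ x (inj₂ i) | yes refl | _ = owner′-y (owned y i)
      owned′ x i | no _ | no x≢y = trans (owner′-other λ eq → x≢y (trans (sym (owned x i)) eq)) (owned x i)

      injective-node : Injective (node (part u) (part y))
      injective-node (inj₁ i) (inj₁ j) eq = cong inj₁ (injective u i j eq)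
      injective-node (inj₂ i) (inj₂ j) eq = cong inj₂ (injective y i j eq)
      injective-node (inj₁ i) (inj₂ j) eq = ⊥-elim (parent≢child (trans (sym (owned u i)) (trans (cong (owner ∘ home) eq) (owned y j))))
      injective-node (inj₂ i) (inj₁ j) eq = ⊥-elim (parent≢child (trans (sym (owned u j)) (trans (cong (owner ∘ home) (sym eq)) (owned y i))))

      injective′ : ∀ x → Injective (part′ x)
      injective′ x with x ≟ u | x ≟ y
      ... | yes _ | _ = injective-node
      ... | no _ | yes _ = λ ()
      ... | no _ | no _ = injective x

      part′-p : part′ u ≡ node (part u) (part y)
      part′-p with u ≟ u | u ≟ y
      ... | yes _ | _ = refl
      ... | no p≢p | _ = ⊥-elim (p≢p refl)

      located-p : ∀ {e} → (∃ λ i → label (node (part u) (part y)) i ≡ e) → ∃ λ i → label (part′ u) i ≡ e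
      located-p {e} = subst (λ t → ∃ λ i → label t i ≡ e) (sym part′-p)

      located-other : ∀ x {e} → x ≢ y → (∃ λ i → label (part x) i ≡ e) → ∃ λ i → label (part′ x) i ≡ e
      located-other x x≢y (i , eq) with x ≟ u | x ≟ y
      ... | yes refl | _ = inj₁ i , eq
      ... | no _ | yes x≡y = ⊥-elim (x≢y x≡y)
      ... | no _ | no _ = i , eq

      located′ : ∀ e → ∃ λ i → label (part′ (owner′ (home e))) i ≡ e
      located′ e with owner (home e) ≟ y | located e
      ... | yes eq | loc = located-p (let i , l = subst (λ z → ∃ λ i → label (part z) i ≡ e) eq loc in inj₂ i , l)
      ... | no ≢y | loc = located-other _ ≢y loc

      portals′ : ∀ {a b} → Adj T a b → owner′ a ≢ owner′ b → owner′ a ≡ a × owner′ b ≡ b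
      portals′ {a} {b} adj o≢ with owner a ≟ y | owner b ≟ y
      ... | yes _ | yes _ = ⊥-elim (o≢ refl)
      ... | yes oa | no ob = ⊥-elim (o≢ (sym (trans (cong owner (proj₂ (neighbour adj oa ob))) owner-p)))
      ... | no oa | yes ob = ⊥-elim (o≢ (trans (cong owner (proj₂ (neighbour (Adj-sym adj) ob oa))) owner-p))
      ... | no _ | no _ = portals adj o≢

      owner′∈ : ∀ x → owner′ x ∈ S′
      owner′∈ x with owner x ≟ y
      ... | yes _ = ∈-filter⁺ keep? parent∈ parent≢child
      ... | no ≢y = ∈-filter⁺ keep? (owner∈ x) ≢y

      owner′-S : ∀ {x} → x ∈ S′ → owner′ x ≡ x
      owner′-S x∈ = let x∈S , x≢y = ∈-filter⁻ keep? {xs = S} x∈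
                        o = owner-S x∈S
                    in trans (owner′-other (λ eq → x≢y (trans (sym o) eq))) o

      merged : Clustering S′
      merged = record
        { owner = owner′ ; owner∈ = owner′∈ ; owner-S = owner′-S ; portals = portals′ ; part = part′
        ; good = good′ ; located = located′ ; owned = owned′ ; injective = injective′ }

    -- Each merge removes a representative, so the length of `S` decreases. The list never becomes
    -- empty, because it contains the owner of a node of the tree.
    collapse : ∀ k S → length S ≤ k → Unique S → Vertex T → Clustering S → Layout K
    collapse k [] _ _ x C with Clustering.owner∈ C x
    ... | ()
    collapse k (r ∷ []) _ _ _ C = record
      { layout = part r ; boundary = bag D r ; narrow = bag≤ r ; good = good r
      ; position = λ e → subst (λ x → ∃ λ i → label (part x) i ≡ e) (only (owner∈ (home e))) (located e)
      ; injective = injective r }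
      where
      open Clustering C
      only : ∀ {x} → x ∈ r ∷ [] → x ≡ r
      only (here eq) = eq
    collapse (suc k) S@(x ∷ y ∷ _) len unique@((x≢y ∷ _) ∷ _) v C =
      collapse k S′ (s≤s⁻¹ (≤-trans smaller len)) (Unique.filter⁺ keep? unique) v merged
      where open Merge C (findLeaf (proj₂ (proj₂ (isTree D))) S (here refl) (there (here refl)) x≢y)

    decomposed : Layout K
    decomposed = collapse _ _ ≤-refl (Unique.allFin⁺ (n T)) (fromℕ< (proj₁ (isTree D))) initial

-- Parity, maxima and congestion of indexed families

xorSum-cong : {f g : Fin ℓ → Bool} → f ≗ g → xorSum f ≡ xorSum g
xorSum-cong {zero} eq = refl
xorSum-cong {suc ℓ} eq = cong₂ _xor_ (eq zero) (xorSum-cong (eq ∘ suc))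

xorSum-𝟎 : ∀ k → xorSum {k} 𝟎 ≡ false
xorSum-𝟎 zero = refl
xorSum-𝟎 (suc k) = xorSum-𝟎 k

xorSum-⊞ : (f g : Fin ℓ → Bool) → xorSum (f ⊞ g) ≡ xorSum f xor xorSum g
xorSum-⊞ {zero} f g = refl
xorSum-⊞ {suc ℓ} f g =
  trans (cong ((f zero xor g zero) xor_) (xorSum-⊞ (f ∘ suc) (g ∘ suc))) (xor-interchange (f zero) (g zero) _ _)

xorSum-δ : ∀ b (i : Fin ℓ) (g : Fin ℓ → Bool) → xorSum (λ j → (b ∧ does (j ≟ i)) ∧ g j) ≡ b ∧ g i
xorSum-δ {suc ℓ} b zero g = begin
  ((b ∧ true) ∧ g zero) xor xorSum (λ j → (b ∧ false) ∧ g (suc j))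
    ≡⟨ cong₂ _xor_ (cong (_∧ g zero) (∧-identityʳ b)) (trans (xorSum-cong {g = 𝟎} (λ j → cong (_∧ g (suc j)) (∧-zeroʳ b))) (xorSum-𝟎 ℓ)) ⟩
  (b ∧ g zero) xor false ≡⟨ xor-identityʳ _ ⟩
  b ∧ g zero ∎
  where open ≡-Reasoning
xorSum-δ {suc ℓ} b (suc i) g = cong₂ _xor_ (cong (_∧ g zero) (∧-zeroʳ b)) (xorSum-δ b i (g ∘ suc))

xorSum-parity : (f : Fin ℓ → Bool) → ∃ λ q → count f ≡ (if xorSum f then 1 else 0) + 2 * q
xorSum-parity {zero} f = 0 , refl
xorSum-parity {suc ℓ} f with f zero | xorSum (f ∘ suc) | xorSum-parity (f ∘ suc)
... | false | _     | q , eq = q , eq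
... | true  | false | q , eq = q , cong suc eq
... | true  | true  | q , eq = suc q , trans (cong suc eq) (cong suc (sym (+-suc q (q + 0))))

xorSum⇒Even : (f : Fin ℓ → Bool) → xorSum f ≡ false → Even (count f)
xorSum⇒Even f eq = let q , c = xorSum-parity f in q , trans c (cong (λ b → (if b then 1 else 0) + 2 * q) eq)

Even⇒xorSum : (f : Fin ℓ → Bool) → Even (count f) → xorSum f ≡ false
Even⇒xorSum f (q , c) with xorSum f | xorSum-parity f
... | false | _ = refl
... | true | q′ , c′ = ⊥-elim (even≢odd q q′ (trans (sym c) c′))

maxF-≤ : ∀ {B} (f : Fin ℓ → ℕ) → (∀ i → f i ≤ B) → maxF f ≤ B
maxF-≤ {zero} f le = z≤n
maxF-≤ {suc ℓ} f le = ⊔-lub (le zero) (maxF-≤ (f ∘ suc) (le ∘ suc))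

≤-maxF : (f : Fin ℓ → ℕ) → ∀ i → f i ≤ maxF f
≤-maxF f zero = m≤m⊔n _ _
≤-maxF f (suc i) = ≤-trans (≤-maxF (f ∘ suc) i) (m≤n⊔m (f zero) _)

count-lookup : ∀ {I} (L : List (F₂ I)) i → count (λ j → List.lookup L j i) ≡ congestionAt L i
count-lookup [] i = refl
count-lookup (X ∷ L) i = cong ((if X i then 1 else 0) +_) (count-lookup L i)

congestionAt-⊆ : ∀ {I} {L M : List (F₂ I)} → L ⊆ M → ∀ i → congestionAt L i ≤ congestionAt M i
congestionAt-⊆ [] i = z≤n
congestionAt-⊆ (X ∷ʳ sub) i = ≤-trans (congestionAt-⊆ sub i) (m≤n+m _ _)
congestionAt-⊆ (refl ∷ sub) i = +-monoʳ-≤ _ (congestionAt-⊆ sub i)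

xorSum-combination : (L : List (F₂ (Fin ℓ))) (c : Fin (length L) → Bool) →
                     ∀ e → xorSum (λ i → c i ∧ List.lookup L i e) ≡ combination id L (Vec.tabulate c) e
xorSum-combination [] c e = refl
xorSum-combination (X ∷ L) c e = cong ((c zero ∧ X e) xor_) (xorSum-combination L (c ∘ suc) e)

tabulate-0̂ : (c : Fin ℓ → Bool) → Vec.tabulate c ≡ 0̂ → ∀ i → c i ≡ false
tabulate-0̂ c eq zero = cong Vec.head eq
tabulate-0̂ c eq (suc i) = tabulate-0̂ (c ∘ suc) (cong Vec.tail eq) i

-- From generating null sets to a cycle basis

module Transfer (G : Graph) where
  open Incidence G

  parity : EdgeSet G → Vertex G → Bool
  parity X v = xorSum (λ e → X e ∧ h e v)

  -- Repeated labels would add up mod 2, so parities agree for every tree; injectivity enters only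
  -- when single edges are read off.
  pushforward : ∀ t → F₂ (Pos t) → EdgeSet G
  pushforward nil X = 𝟎
  pushforward (leaf e) X e′ = X tt ∧ does (e′ ≟ e)
  pushforward (node l r) X = pushforward l (X ∘ inj₁) ⊞ pushforward r (X ∘ inj₂)

  parity-pushforward : ∀ t X v → parity (pushforward t X) v ≡ ∂ t X v
  parity-pushforward nil X v = xorSum-𝟎 (m G)
  parity-pushforward (leaf e) X v = xorSum-δ (X tt) e (λ e → h e v)
  parity-pushforward (node l r) X v = begin
    xorSum (λ e → (Xₗ e xor Xᵣ e) ∧ h e v)               ≡⟨ xorSum-cong (λ e → ∧-distribʳ-xor (h e v) (Xₗ e) (Xᵣ e)) ⟩
    xorSum (λ e → (Xₗ e ∧ h e v) xor (Xᵣ e ∧ h e v))     ≡⟨ xorSum-⊞ (λ e → Xₗ e ∧ h e v) (λ e → Xᵣ e ∧ h e v) ⟩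
    parity Xₗ v xor parity Xᵣ v                          ≡⟨ cong₂ _xor_ (parity-pushforward l _ v) (parity-pushforward r _ v) ⟩
    ∂ (node l r) X v                                     ∎
    where
    open ≡-Reasoning
    Xₗ = pushforward l (X ∘ inj₁)
    Xᵣ = pushforward r (X ∘ inj₂)

  pushforward-∉ : ∀ t X e → (∀ i → label t i ≢ e) → pushforward t X e ≡ false
  pushforward-∉ nil X e ∉ = refl
  pushforward-∉ (leaf e′) X e ∉ with e ≟ e′
  ... | yes eq = ⊥-elim (∉ tt (sym eq))
  ... | no _ = ∧-zeroʳ (X tt)
  pushforward-∉ (node l r) X e ∉ = cong₂ _xor_ (pushforward-∉ l _ e (∉ ∘ inj₁)) (pushforward-∉ r _ e (∉ ∘ inj₂))

  pushforward-label : ∀ t X → Injective t → ∀ i → pushforward t X (label t i) ≡ X i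
  pushforward-label (leaf e) X inj tt with e ≟ e
  ... | yes _ = ∧-identityʳ (X tt)
  ... | no e≢e = ⊥-elim (e≢e refl)
  pushforward-label (node l r) X inj (inj₁ i) =
    trans (cong₂ _xor_ (pushforward-label l _ (λ i j eq → unInj₁ (inj (inj₁ i) (inj₁ j) eq)) i)
                       (pushforward-∉ r _ (label l i) λ j eq → inj₁≢inj₂ (inj (inj₁ i) (inj₂ j) (sym eq))))
          (xor-identityʳ _)
    where
    unInj₁ : ∀ {i j} → inj₁ i ≡ inj₁ j → i ≡ j
    unInj₁ refl = refl
    inj₁≢inj₂ : ∀ {i j} → inj₁ i ≢ inj₂ j
    inj₁≢inj₂ ()
  pushforward-label (node l r) X inj (inj₂ i) =
    cong₂ _xor_ (pushforward-∉ l _ (label r i) λ j eq → inj₁≢inj₂ (inj (inj₁ j) (inj₂ i) eq))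
                (pushforward-label r _ (λ i j eq → unInj₂ (inj (inj₂ i) (inj₂ j) eq)) i)
    where
    unInj₂ : ∀ {i j} → inj₂ i ≡ inj₂ j → i ≡ j
    unInj₂ refl = refl
    inj₁≢inj₂ : ∀ {i j} → inj₁ i ≢ inj₂ j
    inj₁≢inj₂ ()

  module _ {K} (L : Layout K) where
    open Layout L
    open Width K using (P; route; module Routing; Routing)
    open Demand P using (loadBound)

    at : Edge G → Pos layout
    at e = proj₁ (position e)

    label-at : ∀ e → label layout (at e) ≡ e
    label-at e = proj₂ (position e)

    parity-at : ∀ X v → parity (X ∘ at) v ≡ ∂ layout X v
    parity-at X v = trans
      (xorSum-cong λ e → cong (_∧ h e v) (trans (sym (pushforward-label layout X injective (at e))) (cong (pushforward layout X) (label-at e))))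
      (parity-pushforward layout X v)

    -- With no vectors demanded at the root, the routing amounts to a generating set of null sets
    -- with bounded load.
    routing : Routing layout [] (Demand.demand P [])
    routing = route layout narrow good 0 [] (λ { [] v _ → ∂-𝟎 layout v }) z≤n [] tt

    open Routing routing using (null; spans; load) renaming (cycles to nullSets)

    generators : List (EdgeSet G)
    generators = map (_∘ at) nullSets

    generators-congestion : ∀ e → congestionAt generators e ≤ loadBound
    generators-congestion e = ≤-trans (≤-reflexive (Σₗ-map _ (_∘ at) nullSets)) (≤-trans (m≤n+m _ _) (load (at e)))

    generators-cycles : All (IsF2Cycle G) generators
    generators-cycles = All.map⁺ (All.map (λ {Z} e v → xorSum⇒Even (λ e → Z (at e) ∧ h e v) (trans (parity-at Z v) (e v))) null)

    -- Passing to an independent sublist keeps the span and cannot raise the congestion.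
    selection : Selection id generators
    selection = select id generators

    open Selection selection using (chosen; sublist; independent) renaming (spanning to selected)

    spanned : ∀ {X} → Span nullSets X → ∃ λ c → X ∘ at ≗ combination id chosen c
    spanned (zero eq) = 0̂ , λ e → trans (eq (at e)) (sym (lin-0̂ (Vec.map id (Vec.fromList chosen)) e))
    spanned (add z∈ s eq) =
      let c , z≗ = selected (∈-map⁺ (_∘ at) z∈)
          d , y≗ = spanned s
      in c ⊹ d , λ e → trans (eq (at e)) (trans (cong₂ _xor_ (z≗ e) (y≗ e)) (sym (lin-⊹ c d (Vec.map id (Vec.fromList chosen)) e)))

    cycle-null : ∀ C → IsF2Cycle G C → ∂ layout (C ∘ label layout) ≗ 𝟎
    cycle-null C cyc v = trans (sym (parity-at (C ∘ label layout) v))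
      (trans (xorSum-cong λ e → cong (λ e′ → C e′ ∧ h e v) (label-at e)) (Even⇒xorSum (λ e → C e ∧ h e v) (cyc v)))

    basis : CycleBasis G
    basis = record
      { size = length chosen
      ; elems = List.lookup chosen
      ; cycles = λ i → All.lookup (All-resp-⊆ sublist generators-cycles) (∈-lookup i)
      ; indep = λ c eq → tabulate-0̂ c (independent (Vec.tabulate c) λ e → trans (sym (xorSum-combination chosen c e)) (eq e))
      ; spanning = λ C cyc → let c , eq = spanned (spans _ (cycle-null C cyc)) in
          Vec.lookup c , λ e → trans (xorSum-combination chosen (Vec.lookup c) e)
            (trans (cong (λ d → combination id chosen d e) (Vec.tabulate∘lookup c))
              (trans (sym (eq e)) (cong C (label-at e))))
      }

    basisNumber : BasisNumberAtMost G loadBound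
    basisNumber = basis , maxF-≤ _ λ e → ≤-trans (≤-reflexive (count-lookup chosen e))
      (≤-trans (congestionAt-⊆ sublist e) (generators-congestion e))

bound : ℕ → ℕ
bound k = Demand.loadBound (suc k + suc k)

theorem1p5 : ∃ λ (f : ℕ → ℕ) → ∀ (k : ℕ) (G : Graph) → Treewidth G k → BasisNumberAtMost G (f k)
theorem1p5 = bound , λ { k G ((D , refl) , _) → Transfer.basisNumber G
  -- The width is the largest bag size minus 1, truncated at 0, so `suc (width D)` bounds every bag
  -- even if all are empty.
  (Incidence.Decomposed.decomposed G D (suc (width D)) λ x → ≤-trans (≤-maxF (count ∘ bag D) x) (m≤n+m∸n _ 1)) }
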